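{- The competitive ratio of $\textsc{Bins}^*$ for $\mathcal{D}_{\infty}^{<}(m / \log m)$ is $O(\log m)$; that is, there is an absolute constant $c$ such that $p_{\textsc{Bins}^*}(D)\le c\log m\cdot p_*(D)$ for every $D\in \mathcal{D}_{\infty}^{<}(m / \log m)$.
   Context: Fix $m\in\mathbb N$ (large enough that the construction below is defined) and the universe of IDs $[m]=\{1,\dots,m\}$; $\log$ is base 2. An ID-generation algorithm $\mathcal A$ is a probability distribution over orderings of IDs of $[m]$: an instance draws an ordering and answers its $t$-th request with the $t$-th entry. A demand profile $D=(d_1,\dots,d_n)\in[m]^n$ means $n$ instances with independent randomness, instance $i$ receiving $d_i$ requests one at a time without knowing $d_i$ in advance. A collision occurs if the sets of IDs output by the instances are not pairwise disjoint; $p_{\mathcal A}(D)$ is the collision probability and $p_*(D)=\min_{\mathcal A'}p_{\mathcal A'}(D)$ over all algorithms. $\mathcal D_\infty^{<}(h)=\bigcup_{i\ge2}\{D\in[m]^i: \max_j d_j<h\}$. Algorithm $\textsc{Bins}^*$: let $C=\lceil \log m-\log\log m\rceil$; partition part of $[m]$ into $C$ disjoint chunks of $2^{C-1}$ IDs each (possible since $C2^{C-1}\le m$), and partition the $i$-th chunk ($i\in[C]$) into $2^{C-i}$ bins of $2^{i-1}$ IDs each. An instance picks a uniformly random bin of chunk 1 (size 1), then a uniformly random bin of chunk 2 (size 2), then of chunk 3 (size 4), and so on, returning all IDs of a bin in increasing order before moving on to the next bin.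
   Formalization: The competing algorithms range over probability distributions on orderings with rational weights rather than arbitrary real ones, so the minimum p_* is over these; log m in the bound is written as its ceiling, which only changes the absolute constant. -}

module Defs where

open import Data.Nat as ℕ using (ℕ; zero; suc; _∸_; _^_; _≤ᵇ_)
open import Data.Integer using (+_)
open import Data.Bool using (Bool; true; false; if_then_else_; not)
open import Data.List using (List; []; _∷_; _++_; map; concatMap; upTo; filter; take; foldr)
open import Data.List.Relation.Binary.Permutation.Propositional using (_↭_)
open import Data.List.Relation.Unary.All using (All)
open import Data.List.Membership.DecPropositional ℕ._≟_ using (_∈?_)
open import Data.Rational as ℚ using (ℚ; 0ℚ; 1ℚ; ½)
open import Data.Product using (_×_; _,_; proj₁; proj₂)
open import Relation.Nullary using (¬?; does)
open import Relation.Binary.PropositionalEquality using (_≡_)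

-- Conventions
--   * IDs are 0,1,…,m-1 (a relabelling of [m] = {1,…,m}).
--   * An ordering of the IDs is a list that is a permutation of upTo m.
--   * An ID-generation algorithm is a probability distribution over
--     orderings; we represent it by a finite list of (probability, ordering)
--     pairs with nonnegative rational weights summing to 1.

ℕ→ℚ : ℕ → ℚ
ℕ→ℚ n = + n ℚ./ 1

sumℚ : List ℚ → ℚ
sumℚ = foldr ℚ._+_ 0ℚ

record Algorithm (m : ℕ) : Set where
  field
    support     : List (ℚ × List ℕ)
    nonneg      : All (λ wo → 0ℚ ℚ.≤ proj₁ wo) support
    sums-to-one : sumℚ (map proj₁ support) ≡ 1ℚ
    orderings   : All (λ wo → proj₂ wo ↭ upTo m) support
open Algorithm public

disjointᵇ : List ℕ → List ℕ → Bool
disjointᵇ xs S = foldr (λ x b → if does (x ∈? S) then false else b) true xs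

-- Probability that instances with the given demands (each drawing an
-- ordering independently from the weighted list, and outputting its prefix
-- of length equal to its demand) output pairwise disjoint sets, which are
-- moreover disjoint from the already used set S.
noCollision : List (ℚ × List ℕ) → List ℕ → List ℕ → ℚ
noCollision A []       S = 1ℚ
noCollision A (d ∷ ds) S =
  sumℚ (map (λ wo → if disjointᵇ (take d (proj₂ wo)) S
                      then proj₁ wo ℚ.* noCollision A ds (take d (proj₂ wo) ++ S)
                      else 0ℚ) A)

pColl : List (ℚ × List ℕ) → List ℕ → ℚ
pColl A D = 1ℚ ℚ.- noCollision A D []

-- C = ⌈log m − log log m⌉ (for m ≥ 2) is the least natural number C with
-- 2^C · log m ≥ m, i.e. with m^(2^C) ≥ 2^m.  (C ≤ m always works.)
findC : ℕ → ℕ → ℕ → ℕ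
findC m k zero      = k
findC m k (suc fuel) = if 2 ^ m ≤ᵇ m ^ (2 ^ k) then k else findC m (suc k) fuel

binsC : ℕ → ℕ
binsC m = findC m 0 m

-- Chunk i = k+1 (k = 0,…,C-1) consists of the IDs k·2^(C-1), …, (k+1)·2^(C-1) - 1
-- and is split into 2^(C-1-k) bins of 2^k consecutive IDs each.
-- A choice is a list (j_0,…,j_{C-1}) with j_k < 2^(C-1-k), the bin chosen in chunk k+1.
choices : List ℕ → List (List ℕ)
choices []       = [] ∷ []
choices (r ∷ rs) = concatMap (λ j → map (j ∷_) (choices rs)) (upTo r)

binRanges : ℕ → List ℕ
binRanges C = map (λ k → 2 ^ (C ∸ suc k)) (upTo C)

binsPrefix : ℕ → ℕ → List ℕ → List ℕ
binsPrefix C k []       = []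
binsPrefix C k (j ∷ js) =
  map (λ t → k ℕ.* 2 ^ (C ∸ 1) ℕ.+ j ℕ.* 2 ^ k ℕ.+ t) (upTo (2 ^ k))
  ++ binsPrefix C (suc k) js

binsOrdering : ℕ → ℕ → List ℕ → List ℕ
binsOrdering m C js =
  binsPrefix C 0 js ++ filter (λ x → ¬? (x ∈? binsPrefix C 0 js)) (upTo m)

powℚ : ℚ → ℕ → ℚ
powℚ q zero    = 1ℚ
powℚ q (suc n) = q ℚ.* powℚ q n

binsWeight : ℕ → ℚ
binsWeight C = powℚ ½ (foldr ℕ._+_ 0 (map (λ k → C ∸ suc k) (upTo C)))

binsSupport : ℕ → List (ℚ × List ℕ)
binsSupport m =
  map (λ js → (binsWeight (binsC m) , binsOrdering m (binsC m) js))
      (choices (binRanges (binsC m)))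

{-# OPTIONS --safe #-}

-- Let X be the sum of min(dᵢ, dⱼ) over all pairs of instances.  Both collision
-- probabilities are compared with X / m.
--
-- Upper bound for Bins*: two instances collide only if they choose the same bin of
-- some chunk that both reach, and the probabilities 2^k / 2^(C-1) over the levels k
-- reached add up to O(min(dᵢ, dⱼ) / 2^C) = O(log m · min(dᵢ, dⱼ) / m).  A union bound
-- over pairs gives p(Bins*) = O(log m · X / m).
--
-- Lower bound for any algorithm: let the instance with the smallest demand d come
-- last, let π(x) be the probability that x is among its IDs, and call x heavy if
-- π(x) ≥ τ = d / (2m).  On average at least half of the first d IDs of an instance are
-- heavy, so unless the others collide with constant probability already, they
-- occupy ID sets of total π-mass at least of order (number of instances) · τ d.  The
-- expected number of IDs shared with the last instance is this mass, and
-- it shares at most d of them, so the no-collision probability n drops by at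
-- least (number of instances) · τ · (n - 1/2).  Adding instances in decreasing order of
-- demand, the collision probability is at least min(1/4, X / (8m)).

module Submission where

open import Defs
open import Data.Nat using (ℕ; _≤_; _<_; _^_; _*_)
open import Data.Nat.Logarithm using (⌈log₂_⌉)
open import Data.List using (List; length)
open import Data.List.Relation.Unary.All using (All)
open import Data.Product using (_×_; ∃-syntax)
open import Data.Rational as ℚ using ()

open import Data.Bool using (Bool; true; false; if_then_else_; _∧_; T)
open import Data.Empty using (⊥; ⊥-elim)
open import Data.Integer as ℤ using (+_)
import Data.Integer.Properties as ℤ
open import Data.List using ([]; _∷_; _++_; map; concatMap; applyUpTo; foldr; take; drop; upTo)
open import Data.List.Membership.Propositional using (_∈_; _∉_)
open import Data.List.Membership.Propositional.Properties
  using (∈-++⁺ˡ; ∈-++⁺ʳ; ∈-++⁻; ∈-map⁻; ∈-upTo⁻)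
open import Data.List.Properties
  using (length-++; length-map; length-take; length-upTo; map-∘; map-upTo; take++drop≡id)
open import Data.List.Relation.Binary.Disjoint.Propositional using (Disjoint)
open import Data.List.Relation.Binary.Permutation.Propositional as ↭ using (_↭_)
open import Data.List.Relation.Binary.Permutation.Propositional.Properties
  using (↭-length; ∷↭∷ʳ; All-resp-↭)
import Data.List.Relation.Binary.Permutation.Setoid.Properties as ↭ₛ
open import Data.List.Relation.Unary.All as All using ([]; _∷_)
open import Data.List.Relation.Unary.All.Properties using (concat⁺; map⁺)
open import Data.List.Relation.Unary.AllPairs using (AllPairs; []; _∷_)
open import Data.List.Relation.Unary.Any using (here; there)
open import Data.List.Relation.Unary.Linked.Properties using (Linked⇒AllPairs)
open import Data.List.Relation.Unary.Unique.Propositional using (Unique)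
open import Data.List.Relation.Unary.Unique.Propositional.Properties using (upTo⁺)
open import Data.Nat as ℕ using (zero; suc; z≤n; s≤s; _∸_; _≤ᵇ_; ⌈_/2⌉)
open import Data.Nat.Induction using (<-rec)
open import Data.Nat.Logarithm using (⌈log₂⌉-mono-≤; ⌈log₂⌈n/2⌉⌉≡⌈log₂n⌉∸1)
import Data.Nat.Properties as ℕ
open import Data.Nat.Solver using () renaming (module +-*-Solver to ℕ-Solver)
open import Data.Product using (_,_; proj₁; proj₂)
open import Data.Rational using (ℚ; 0ℚ; 1ℚ; ½)
import Data.Rational.Properties as ℚ
open import Data.Rational.Solver using (module +-*-Solver)
import Data.Rational.Unnormalised as ℚᵘ
import Data.Rational.Unnormalised.Properties as ℚᵘ
open import Data.Sum using (_⊎_; inj₁; inj₂; [_,_]′)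
open import Data.Unit using (tt)
open import Function using (_∘_; mk⇔)
open import Relation.Binary.Definitions using (tri<; tri≈; tri>)
open import Relation.Binary.PropositionalEquality
open import Relation.Nullary using (Dec; yes; no; does; ¬_; Reflects; ofʸ; ofⁿ; _because_)
open import Relation.Nullary.Decidable using (dec-true; dec-false; does-⇔; _×-dec_)

open import Data.List.Membership.DecPropositional ℕ._≟_ using (_∈?_)
open import Data.List.Sort ℕ.≤-decTotalOrder using (sort; sort-↭; sort-↗)
open +-*-Solver using (solve; _:+_; _:*_; _:-_; :-_; _:=_; con)

-- Rational arithmetic

slack : ∀ {p q} → p ℚ.≤ q → 0ℚ ℚ.≤ q ℚ.- p
slack {p} {q} p≤q = begin
  0ℚ      ≡⟨ ℚ.+-inverseʳ p ⟨
  p ℚ.- p ≤⟨ ℚ.+-monoˡ-≤ (ℚ.- p) p≤q ⟩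
  q ℚ.- p ∎
  where open ℚ.≤-Reasoning

-- Reduces an inequality to a ring identity: `r` is written as a sum of products of nonnegative
-- terms, and the solver checks that it fills the gap from `p` to `q`. Most rational estimates below
-- are certificates of this kind.
≤-from-slack : ∀ {p q r} → 0ℚ ℚ.≤ r → p ℚ.+ r ≡ q → p ℚ.≤ q
≤-from-slack {p} {q} {r} 0≤r p+r≡q = begin
  p        ≡⟨ ℚ.+-identityʳ p ⟨
  p ℚ.+ 0ℚ ≤⟨ ℚ.+-monoʳ-≤ p 0≤r ⟩
  p ℚ.+ r  ≡⟨ p+r≡q ⟩
  q        ∎
  where open ℚ.≤-Reasoning

+-nonneg : ∀ {p q} → 0ℚ ℚ.≤ p → 0ℚ ℚ.≤ q → 0ℚ ℚ.≤ p ℚ.+ q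
+-nonneg = ℚ.+-mono-≤

*-monoˡ : ∀ {r p q} → 0ℚ ℚ.≤ r → p ℚ.≤ q → r ℚ.* p ℚ.≤ r ℚ.* q
*-monoˡ {r} 0≤r = ℚ.*-monoˡ-≤-nonNeg r {{ℚ.nonNegative 0≤r}}

*-nonneg : ∀ {p q} → 0ℚ ℚ.≤ p → 0ℚ ℚ.≤ q → 0ℚ ℚ.≤ p ℚ.* q
*-nonneg {p} {q} 0≤p 0≤q = begin
  0ℚ       ≡⟨ ℚ.*-zeroʳ p ⟨
  p ℚ.* 0ℚ ≤⟨ *-monoˡ 0≤p 0≤q ⟩
  p ℚ.* q  ∎
  where open ℚ.≤-Reasoning

-- Unnormalised rationals make the arithmetic of `ℕ→ℚ` a matter of integers, with no gcd to reduce.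
toℚᵘ-ℕ→ℚ : ∀ n → ℚ.toℚᵘ (ℕ→ℚ n) ℚᵘ.≃ ℚᵘ.mkℚᵘ (+ n) 0
toℚᵘ-ℕ→ℚ n = ℚ.toℚᵘ-fromℚᵘ (ℚᵘ.mkℚᵘ (+ n) 0)

ℕ→ℚ-+ : ∀ a b → ℕ→ℚ (a ℕ.+ b) ≡ ℕ→ℚ a ℚ.+ ℕ→ℚ b
ℕ→ℚ-+ a b = ℚ.toℚᵘ-injective (begin
  ℚ.toℚᵘ (ℕ→ℚ (a ℕ.+ b))                   ≈⟨ toℚᵘ-ℕ→ℚ (a ℕ.+ b) ⟩
  ℚᵘ.mkℚᵘ (+ (a ℕ.+ b)) 0                   ≈⟨ ℚᵘ.*≡* (cong (ℤ._* + 1) (cong₂ ℤ._+_ (sym (ℤ.*-identityʳ (+ a))) (sym (ℤ.*-identityʳ (+ b))))) ⟩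
  ℚᵘ.mkℚᵘ (+ a) 0 ℚᵘ.+ ℚᵘ.mkℚᵘ (+ b) 0     ≈⟨ ℚᵘ.+-cong (toℚᵘ-ℕ→ℚ a) (toℚᵘ-ℕ→ℚ b) ⟨
  ℚ.toℚᵘ (ℕ→ℚ a) ℚᵘ.+ ℚ.toℚᵘ (ℕ→ℚ b)     ≈⟨ ℚ.toℚᵘ-homo-+ (ℕ→ℚ a) (ℕ→ℚ b) ⟨
  ℚ.toℚᵘ (ℕ→ℚ a ℚ.+ ℕ→ℚ b)                ∎)
  where open ℚᵘ.≃-Reasoning

ℕ→ℚ-* : ∀ a b → ℕ→ℚ (a * b) ≡ ℕ→ℚ a ℚ.* ℕ→ℚ b
ℕ→ℚ-* a b = ℚ.toℚᵘ-injective (begin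
  ℚ.toℚᵘ (ℕ→ℚ (a * b))                   ≈⟨ toℚᵘ-ℕ→ℚ (a * b) ⟩
  ℚᵘ.mkℚᵘ (+ (a * b)) 0                   ≈⟨ ℚᵘ.*≡* (cong (ℤ._* + 1) (ℤ.pos-* a b)) ⟩
  ℚᵘ.mkℚᵘ (+ a) 0 ℚᵘ.* ℚᵘ.mkℚᵘ (+ b) 0     ≈⟨ ℚᵘ.*-cong (toℚᵘ-ℕ→ℚ a) (toℚᵘ-ℕ→ℚ b) ⟨
  ℚ.toℚᵘ (ℕ→ℚ a) ℚᵘ.* ℚ.toℚᵘ (ℕ→ℚ b)     ≈⟨ ℚ.toℚᵘ-homo-* (ℕ→ℚ a) (ℕ→ℚ b) ⟨
  ℚ.toℚᵘ (ℕ→ℚ a ℚ.* ℕ→ℚ b)                ∎)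
  where open ℚᵘ.≃-Reasoning

ℕ→ℚ-nonneg : ∀ n → 0ℚ ℚ.≤ ℕ→ℚ n
ℕ→ℚ-nonneg n = ℚ.nonNegative⁻¹ (ℕ→ℚ n) {{ℚ.normalize-nonNeg n 1}}

ℕ→ℚ-mono : ∀ {a b} → a ≤ b → ℕ→ℚ a ℚ.≤ ℕ→ℚ b
ℕ→ℚ-mono {a} a≤b with c , refl ← ℕ.m≤n⇒∃[o]m+o≡n a≤b =
  ≤-from-slack (ℕ→ℚ-nonneg c) (sym (ℕ→ℚ-+ a c))

ℕ→ℚ-positive : ∀ {n} → 1 ≤ n → ℚ.Positive (ℕ→ℚ n)
ℕ→ℚ-positive {n} 1≤n = ℚ.positive (ℚ.<-≤-trans (ℚ.positive⁻¹ 1ℚ) (ℕ→ℚ-mono 1≤n))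

χ : Bool → ℚ
χ true  = 1ℚ
χ false = 0ℚ

χ-nonneg : ∀ b → 0ℚ ℚ.≤ χ b
χ-nonneg true  = ℚ.nonNegative⁻¹ 1ℚ
χ-nonneg false = ℚ.≤-refl

χ≤1 : ∀ b → χ b ℚ.≤ 1ℚ
χ≤1 true  = ℚ.≤-refl
χ≤1 false = ℚ.nonNegative⁻¹ 1ℚ

χ-∧ : ∀ a b → χ (a ∧ b) ≡ χ a ℚ.* χ b
χ-∧ true  b = sym (ℚ.*-identityˡ (χ b))
χ-∧ false b = sym (ℚ.*-zeroˡ (χ b))

-- Finite sums and expectations

∑ : {B : Set} → List B → (B → ℚ) → ℚ
∑ xs f = sumℚ (map f xs)

∑-cong : {B : Set} {f g : B → ℚ} → (∀ x → f x ≡ g x) → ∀ xs → ∑ xs f ≡ ∑ xs g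
∑-cong f≗g []       = refl
∑-cong f≗g (x ∷ xs) = cong₂ ℚ._+_ (f≗g x) (∑-cong f≗g xs)

∑-mono : {B : Set} {f g : B → ℚ} {xs : List B} → All (λ x → f x ℚ.≤ g x) xs → ∑ xs f ℚ.≤ ∑ xs g
∑-mono []         = ℚ.≤-refl
∑-mono (le ∷ les) = ℚ.+-mono-≤ le (∑-mono les)

∑-+ : {B : Set} (f g : B → ℚ) (xs : List B) → ∑ xs (λ x → f x ℚ.+ g x) ≡ ∑ xs f ℚ.+ ∑ xs g
∑-+ f g []       = refl
∑-+ f g (x ∷ xs) rewrite ∑-+ f g xs =
  solve 4 (λ a b c d → (a :+ b) :+ (c :+ d) := (a :+ c) :+ (b :+ d)) refl (f x) (g x) (∑ xs f) (∑ xs g)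

∑-*ˡ : {B : Set} (c : ℚ) (f : B → ℚ) (xs : List B) → ∑ xs (λ x → c ℚ.* f x) ≡ c ℚ.* ∑ xs f
∑-*ˡ c f []       = sym (ℚ.*-zeroʳ c)
∑-*ˡ c f (x ∷ xs) rewrite ∑-*ˡ c f xs = sym (ℚ.*-distribˡ-+ c (f x) (∑ xs f))

∑-const : {B : Set} (c : ℚ) (xs : List B) → ∑ xs (λ _ → c) ≡ ℕ→ℚ (length xs) ℚ.* c
∑-const c []       = sym (ℚ.*-zeroˡ c)
∑-const c (x ∷ xs) rewrite ∑-const c xs | ℕ→ℚ-+ 1 (length xs) =
  solve 2 (λ c n → c :+ n :* c := (con 1ℚ :+ n) :* c) refl c (ℕ→ℚ (length xs))

∑-zero : {B : Set} (xs : List B) → ∑ xs (λ _ → 0ℚ) ≡ 0ℚ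
∑-zero xs = trans (∑-const 0ℚ xs) (ℚ.*-zeroʳ (ℕ→ℚ (length xs)))

∑-swap : {B C : Set} (F : B → C → ℚ) (xs : List B) (ys : List C) →
         ∑ xs (λ x → ∑ ys (F x)) ≡ ∑ ys (λ y → ∑ xs (λ x → F x y))
∑-swap F []       ys = sym (∑-zero ys)
∑-swap F (x ∷ xs) ys rewrite ∑-swap F xs ys = sym (∑-+ (F x) (λ y → ∑ xs (λ x → F x y)) ys)

∑-++ : {B : Set} (f : B → ℚ) (xs ys : List B) → ∑ (xs ++ ys) f ≡ ∑ xs f ℚ.+ ∑ ys f
∑-++ f []       ys = sym (ℚ.+-identityˡ (∑ ys f))
∑-++ f (x ∷ xs) ys rewrite ∑-++ f xs ys = sym (ℚ.+-assoc (f x) (∑ xs f) (∑ ys f))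

∑-↭ : {B : Set} (f : B → ℚ) {xs ys : List B} → xs ↭ ys → ∑ xs f ≡ ∑ ys f
∑-↭ f ↭.refl         = refl
∑-↭ f (↭.prep x p)   = cong (f x ℚ.+_) (∑-↭ f p)
∑-↭ f (↭.swap {xs} x y p) rewrite ∑-↭ f p =
  solve 3 (λ a b c → a :+ (b :+ c) := b :+ (a :+ c)) refl (f x) (f y) _
∑-↭ f (↭.trans p q)  = trans (∑-↭ f p) (∑-↭ f q)

Weighted : Set → Set
Weighted B = List (ℚ × B)

record IsDistribution {B : Set} (A : Weighted B) : Set where
  field
    weights-nonneg : All (λ wo → 0ℚ ℚ.≤ proj₁ wo) A
    weights-sum    : sumℚ (map proj₁ A) ≡ 1ℚ

-- An expectation once `A` is an `IsDistribution`; linearity and exchange of sums hold for arbitrary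
-- weights.
𝔼 : {B : Set} → Weighted B → (B → ℚ) → ℚ
𝔼 A f = ∑ A (λ wo → proj₁ wo ℚ.* f (proj₂ wo))

𝔼-cong : {B : Set} (A : Weighted B) {f g : B → ℚ} → (∀ o → f o ≡ g o) → 𝔼 A f ≡ 𝔼 A g
𝔼-cong A f≗g = ∑-cong (λ wo → cong (proj₁ wo ℚ.*_) (f≗g (proj₂ wo))) A

𝔼-+ : {B : Set} (A : Weighted B) (f g : B → ℚ) → 𝔼 A (λ o → f o ℚ.+ g o) ≡ 𝔼 A f ℚ.+ 𝔼 A g
𝔼-+ A f g = trans (∑-cong (λ wo → ℚ.*-distribˡ-+ (proj₁ wo) (f (proj₂ wo)) (g (proj₂ wo))) A)
                   (∑-+ (λ wo → proj₁ wo ℚ.* f (proj₂ wo)) (λ wo → proj₁ wo ℚ.* g (proj₂ wo)) A)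

𝔼-*ˡ : {B : Set} (A : Weighted B) (c : ℚ) (f : B → ℚ) → 𝔼 A (λ o → c ℚ.* f o) ≡ c ℚ.* 𝔼 A f
𝔼-*ˡ A c f = trans (∑-cong (λ wo → solve 3 (λ w c x → w :* (c :* x) := c :* (w :* x)) refl (proj₁ wo) c (f (proj₂ wo))) A)
                     (∑-*ˡ c (λ wo → proj₁ wo ℚ.* f (proj₂ wo)) A)

𝔼-*ʳ : {B : Set} (A : Weighted B) (f : B → ℚ) (c : ℚ) → 𝔼 A (λ o → f o ℚ.* c) ≡ 𝔼 A f ℚ.* c
𝔼-*ʳ A f c = trans (𝔼-cong A (λ o → ℚ.*-comm (f o) c))
                     (trans (𝔼-*ˡ A c f) (ℚ.*-comm c (𝔼 A f)))

∑-𝔼-swap : {B C : Set} (F : B → C → ℚ) (xs : List B) (A : Weighted C) →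
          ∑ xs (λ x → 𝔼 A (F x)) ≡ 𝔼 A (λ o → ∑ xs (λ x → F x o))
∑-𝔼-swap F xs A =
  trans (∑-swap (λ x wo → proj₁ wo ℚ.* F x (proj₂ wo)) xs A)
        (∑-cong (λ wo → ∑-*ˡ (proj₁ wo) (λ x → F x (proj₂ wo)) xs) A)

𝔼-swap : {B C : Set} (F : B → C → ℚ) (A : Weighted B) (A′ : Weighted C) →
         𝔼 A (λ o → 𝔼 A′ (F o)) ≡ 𝔼 A′ (λ o′ → 𝔼 A (λ o → F o o′))
𝔼-swap F A A′ =
  trans (∑-cong (λ wo → sym (𝔼-*ˡ A′ (proj₁ wo) (F (proj₂ wo)))) A)
        (∑-𝔼-swap (λ wo o′ → proj₁ wo ℚ.* F (proj₂ wo) o′) A A′)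

module _ {B : Set} {A : Weighted B} (dist : IsDistribution A) where
  open IsDistribution dist

  𝔼-const : ∀ c → 𝔼 A (λ _ → c) ≡ c
  𝔼-const c = begin
    𝔼 A (λ _ → c)                   ≡⟨ ∑-cong (λ wo → ℚ.*-comm (proj₁ wo) c) A ⟩
    ∑ A (λ wo → c ℚ.* proj₁ wo)     ≡⟨ ∑-*ˡ c proj₁ A ⟩
    c ℚ.* ∑ A proj₁                 ≡⟨ cong (c ℚ.*_) weights-sum ⟩
    c ℚ.* 1ℚ                        ≡⟨ ℚ.*-identityʳ c ⟩
    c                               ∎
    where open ≡-Reasoning

  𝔼-affine : ∀ a b c (f g : B → ℚ) →
             𝔼 A (λ o → (a ℚ.* f o ℚ.+ b ℚ.* g o) ℚ.+ c) ≡ (a ℚ.* 𝔼 A f ℚ.+ b ℚ.* 𝔼 A g) ℚ.+ c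
  𝔼-affine a b c f g = begin
    𝔼 A (λ o → (a ℚ.* f o ℚ.+ b ℚ.* g o) ℚ.+ c)
      ≡⟨ 𝔼-+ A (λ o → a ℚ.* f o ℚ.+ b ℚ.* g o) (λ _ → c) ⟩
    𝔼 A (λ o → a ℚ.* f o ℚ.+ b ℚ.* g o) ℚ.+ 𝔼 A (λ _ → c)
      ≡⟨ cong₂ ℚ._+_ (𝔼-+ A (λ o → a ℚ.* f o) (λ o → b ℚ.* g o)) (𝔼-const c) ⟩
    (𝔼 A (λ o → a ℚ.* f o) ℚ.+ 𝔼 A (λ o → b ℚ.* g o)) ℚ.+ c
      ≡⟨ cong (ℚ._+ c) (cong₂ ℚ._+_ (𝔼-*ˡ A a f) (𝔼-*ˡ A b g)) ⟩
    (a ℚ.* 𝔼 A f ℚ.+ b ℚ.* 𝔼 A g) ℚ.+ c ∎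
    where open ≡-Reasoning

  𝔼-mono : {f g : B → ℚ} → All (λ wo → f (proj₂ wo) ℚ.≤ g (proj₂ wo)) A → 𝔼 A f ℚ.≤ 𝔼 A g
  𝔼-mono les = ∑-mono (All.zipWith (λ (0≤w , le) → *-monoˡ 0≤w le) (weights-nonneg , les))

  𝔼-mono-∀ : {f g : B → ℚ} → (∀ o → f o ℚ.≤ g o) → 𝔼 A f ℚ.≤ 𝔼 A g
  𝔼-mono-∀ le = 𝔼-mono (All.universal (λ wo → le (proj₂ wo)) A)

-- The no-collision probability

disjointᵇ-reflects : ∀ xs S → Reflects (Disjoint xs S) (disjointᵇ xs S)
disjointᵇ-reflects []       S = ofʸ λ ()
disjointᵇ-reflects (x ∷ xs) S with x ∈? S
... | yes x∈S = ofⁿ λ disj → disj (here refl , x∈S)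
... | no  x∉S with disjointᵇ xs S | disjointᵇ-reflects xs S
...   | true  | ofʸ disj  = ofʸ λ { (here refl , v∈S) → x∉S v∈S ; (there v∈xs , v∈S) → disj (v∈xs , v∈S) }
...   | false | ofⁿ ¬disj = ofⁿ λ disj → ¬disj λ (v∈xs , v∈S) → disj (there v∈xs , v∈S)

-- Assembled with `because` so that `does` reduces to `disjointᵇ xs S`, the test inside
-- `noCollision`; lemmas about decisions then apply to that test directly.
disjoint? : ∀ xs S → Dec (Disjoint xs S)
disjoint? xs S = disjointᵇ xs S because disjointᵇ-reflects xs S

χdisj : List ℕ → List ℕ → ℚ
χdisj xs S = χ (disjointᵇ xs S)

χ∈ : ℕ → List ℕ → ℚ
χ∈ x S = χ (does (x ∈? S))

-- Used IDs are collected in a list, but only membership matters; the list itself depends on the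
-- order in which the instances are served.
_≈ₛ_ : List ℕ → List ℕ → Set
S ≈ₛ T = ∀ {x} → (x ∈ S → x ∈ T) × (x ∈ T → x ∈ S)

++-congˡ : ∀ R {S T} → S ≈ₛ T → (R ++ S) ≈ₛ (R ++ T)
++-congˡ R S≈T = [ ∈-++⁺ˡ , ∈-++⁺ʳ R ∘ proj₁ S≈T ]′ ∘ ∈-++⁻ R
               , [ ∈-++⁺ˡ , ∈-++⁺ʳ R ∘ proj₂ S≈T ]′ ∘ ∈-++⁻ R

++-exchange : ∀ P Q S → (P ++ Q ++ S) ≈ₛ (Q ++ P ++ S)
++-exchange P Q S = exchange P Q , exchange Q P
  where
  exchange : ∀ P Q {x} → x ∈ P ++ Q ++ S → x ∈ Q ++ P ++ S
  exchange P Q = [ ∈-++⁺ʳ Q ∘ ∈-++⁺ˡ , [ ∈-++⁺ˡ , ∈-++⁺ʳ Q ∘ ∈-++⁺ʳ P ]′ ∘ ∈-++⁻ Q ]′ ∘ ∈-++⁻ P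

χdisj-cong : ∀ xs {S T} → S ≈ₛ T → χdisj xs S ≡ χdisj xs T
χdisj-cong xs {S} {T} S≈T =
  cong χ (does-⇔ (mk⇔ (antitone (proj₂ S≈T)) (antitone (proj₁ S≈T))) (disjoint? xs S) (disjoint? xs T))
  where
  antitone : ∀ {S T} → (∀ {x} → x ∈ T → x ∈ S) → Disjoint xs S → Disjoint xs T
  antitone T⊆S xs#S (v∈xs , v∈T) = xs#S (v∈xs , T⊆S v∈T)

-- Both products indicate that `P` and `Q` avoid `S` and each other, a condition symmetric in `P`
-- and `Q`.
χdisj-exchange : ∀ P Q S → χdisj P S ℚ.* χdisj Q (P ++ S) ≡ χdisj Q S ℚ.* χdisj P (Q ++ S)
χdisj-exchange P Q S = begin
  χdisj P S ℚ.* χdisj Q (P ++ S)                  ≡⟨ χ-∧ (disjointᵇ P S) (disjointᵇ Q (P ++ S)) ⟨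
  χ (disjointᵇ P S ∧ disjointᵇ Q (P ++ S))        ≡⟨ cong χ (does-⇔ (mk⇔ (exchange P Q) (exchange Q P))
                                                       (disjoint? P S ×-dec disjoint? Q (P ++ S))
                                                       (disjoint? Q S ×-dec disjoint? P (Q ++ S))) ⟩
  χ (disjointᵇ Q S ∧ disjointᵇ P (Q ++ S))        ≡⟨ χ-∧ (disjointᵇ Q S) (disjointᵇ P (Q ++ S)) ⟩
  χdisj Q S ℚ.* χdisj P (Q ++ S)                  ∎
  where
  open ≡-Reasoning
  exchange : ∀ P Q → Disjoint P S × Disjoint Q (P ++ S) → Disjoint Q S × Disjoint P (Q ++ S)
  exchange P Q (P#S , Q#PS) =
      (λ (v∈Q , v∈S) → Q#PS (v∈Q , ∈-++⁺ʳ P v∈S))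
    , (λ (v∈P , v∈QS) → [ (λ v∈Q → Q#PS (v∈Q , ∈-++⁺ˡ v∈P)) , (λ v∈S → P#S (v∈P , v∈S)) ]′ (∈-++⁻ Q v∈QS))

module _ (A : Weighted (List ℕ)) where

  -- With the conditional turned into a factor 0 or 1, the linearity laws of `𝔼` apply.
  noCollision-∷ : ∀ d ds S → noCollision A (d ∷ ds) S ≡
    𝔼 A (λ o → χdisj (take d o) S ℚ.* noCollision A ds (take d o ++ S))
  noCollision-∷ d ds S = ∑-cong term A
    where
    term : ∀ wo → (if disjointᵇ (take d (proj₂ wo)) S
                      then proj₁ wo ℚ.* noCollision A ds (take d (proj₂ wo) ++ S)
                      else 0ℚ)
                ≡ proj₁ wo ℚ.* (χdisj (take d (proj₂ wo)) S ℚ.* noCollision A ds (take d (proj₂ wo) ++ S))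
    term (w , o) with disjointᵇ (take d o) S
    ... | true  = cong (w ℚ.*_) (sym (ℚ.*-identityˡ _))
    ... | false = sym (trans (cong (w ℚ.*_) (ℚ.*-zeroˡ (noCollision A ds (take d o ++ S)))) (ℚ.*-zeroʳ w))

  noCollision-cong : ∀ ds {S T} → S ≈ₛ T → noCollision A ds S ≡ noCollision A ds T
  noCollision-cong []       S≈T = refl
  noCollision-cong (d ∷ ds) {S} {T} S≈T = begin
    noCollision A (d ∷ ds) S
      ≡⟨ noCollision-∷ d ds S ⟩
    𝔼 A (λ o → χdisj (take d o) S ℚ.* noCollision A ds (take d o ++ S))
      ≡⟨ 𝔼-cong A (λ o → cong₂ ℚ._*_ (χdisj-cong (take d o) S≈T)
                                      (noCollision-cong ds (++-congˡ (take d o) S≈T))) ⟩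
    𝔼 A (λ o → χdisj (take d o) T ℚ.* noCollision A ds (take d o ++ T))
      ≡⟨ noCollision-∷ d ds T ⟨
    noCollision A (d ∷ ds) T ∎
    where open ≡-Reasoning

  noCollision-∷∷ : ∀ d e ds S → noCollision A (d ∷ e ∷ ds) S ≡
    𝔼 A (λ o → 𝔼 A (λ o′ → (χdisj (take d o) S ℚ.* χdisj (take e o′) (take d o ++ S))
                               ℚ.* noCollision A ds (take e o′ ++ take d o ++ S)))
  noCollision-∷∷ d e ds S = trans (noCollision-∷ d (e ∷ ds) S) (𝔼-cong A λ o →
    trans (cong (χdisj (take d o) S ℚ.*_) (noCollision-∷ e ds (take d o ++ S)))
    (trans (sym (𝔼-*ˡ A (χdisj (take d o) S) _))
    (𝔼-cong A λ o′ → sym (ℚ.*-assoc (χdisj (take d o) S) (χdisj (take e o′) (take d o ++ S)) _))))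

  -- The two draws are independent, so the expectations can be exchanged; the indicators and the
  -- used sets are symmetric in the two prefixes.
  noCollision-swap : ∀ d e ds S → noCollision A (d ∷ e ∷ ds) S ≡ noCollision A (e ∷ d ∷ ds) S
  noCollision-swap d e ds S =
    trans (noCollision-∷∷ d e ds S)
    (trans (𝔼-swap _ A A)
    (trans (𝔼-cong A λ o′ → 𝔼-cong A λ o →
             cong₂ ℚ._*_ (χdisj-exchange (take d o) (take e o′) S)
                         (noCollision-cong ds (++-exchange (take e o′) (take d o) S)))
    (sym (noCollision-∷∷ e d ds S))))

  noCollision-∷-cong : ∀ d ds es → (∀ S → noCollision A ds S ≡ noCollision A es S) →
                       ∀ S → noCollision A (d ∷ ds) S ≡ noCollision A (d ∷ es) S
  noCollision-∷-cong d ds es eq S =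
    trans (noCollision-∷ d ds S)
    (trans (𝔼-cong A λ o → cong (χdisj (take d o) S ℚ.*_) (eq (take d o ++ S)))
    (sym (noCollision-∷ d es S)))

  -- Lets the demands be sorted and the smallest one be served last.
  noCollision-↭ : ∀ {ds es} → ds ↭ es → ∀ S → noCollision A ds S ≡ noCollision A es S
  noCollision-↭ ↭.refl S = refl
  noCollision-↭ (↭.prep {ds} {es} d p) S = noCollision-∷-cong d ds es (noCollision-↭ p) S
  noCollision-↭ (↭.swap {ds} {es} d e p) S =
    trans (noCollision-swap d e ds S)
          (noCollision-∷-cong e (d ∷ ds) (d ∷ es) (noCollision-∷-cong d ds es (noCollision-↭ p)) S)
  noCollision-↭ (↭.trans p q) S = trans (noCollision-↭ p S) (noCollision-↭ q S)

module _ {A : Weighted (List ℕ)} (dist : IsDistribution A) where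

  noCollision-nonneg : ∀ ds S → 0ℚ ℚ.≤ noCollision A ds S
  noCollision-nonneg []       S = ℚ.nonNegative⁻¹ 1ℚ
  noCollision-nonneg (d ∷ ds) S = begin
    0ℚ                       ≡⟨ 𝔼-const dist 0ℚ ⟨
    𝔼 A (λ _ → 0ℚ)           ≤⟨ 𝔼-mono-∀ dist (λ o → *-nonneg (χ-nonneg (disjointᵇ (take d o) S)) (noCollision-nonneg ds (take d o ++ S))) ⟩
    𝔼 A (λ o → χdisj (take d o) S ℚ.* noCollision A ds (take d o ++ S)) ≡⟨ noCollision-∷ A d ds S ⟨
    noCollision A (d ∷ ds) S ∎
    where open ℚ.≤-Reasoning

  -- Further instances only add ways to collide. With `ds` empty this is the bound by 1, obtained by
  -- the same recursion on `es`.
  noCollision-++-≤ : ∀ ds es S → noCollision A (ds ++ es) S ℚ.≤ noCollision A ds S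
  noCollision-++-≤ []       []       S = ℚ.≤-refl
  noCollision-++-≤ []       (e ∷ es) S = begin
    noCollision A (e ∷ es) S  ≡⟨ noCollision-∷ A e es S ⟩
    𝔼 A (λ o → χdisj (take e o) S ℚ.* noCollision A es (take e o ++ S)) ≤⟨ 𝔼-mono-∀ dist bound ⟩
    𝔼 A (λ _ → 1ℚ)            ≡⟨ 𝔼-const dist 1ℚ ⟩
    1ℚ                        ∎
    where
    open ℚ.≤-Reasoning
    bound : ∀ o → χdisj (take e o) S ℚ.* noCollision A es (take e o ++ S) ℚ.≤ 1ℚ
    bound o = begin
      χdisj (take e o) S ℚ.* noCollision A es (take e o ++ S) ≤⟨ *-monoˡ (χ-nonneg (disjointᵇ (take e o) S)) (noCollision-++-≤ [] es (take e o ++ S)) ⟩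
      χdisj (take e o) S ℚ.* 1ℚ                               ≡⟨ ℚ.*-identityʳ _ ⟩
      χdisj (take e o) S                                      ≤⟨ χ≤1 (disjointᵇ (take e o) S) ⟩
      1ℚ ∎
  noCollision-++-≤ (d ∷ ds) es S = begin
    noCollision A (d ∷ ds ++ es) S
      ≡⟨ noCollision-∷ A d (ds ++ es) S ⟩
    𝔼 A (λ o → χdisj (take d o) S ℚ.* noCollision A (ds ++ es) (take d o ++ S))
      ≤⟨ 𝔼-mono-∀ dist (λ o → *-monoˡ (χ-nonneg (disjointᵇ (take d o) S)) (noCollision-++-≤ ds es (take d o ++ S))) ⟩
    𝔼 A (λ o → χdisj (take d o) S ℚ.* noCollision A ds (take d o ++ S))
      ≡⟨ noCollision-∷ A d ds S ⟨
    noCollision A (d ∷ ds) S ∎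
    where open ℚ.≤-Reasoning

  noCollision≤1 : ∀ ds S → noCollision A ds S ℚ.≤ 1ℚ
  noCollision≤1 = noCollision-++-≤ []

  noCollision-∷-≤ : ∀ d ds S → noCollision A (d ∷ ds) S ℚ.≤ noCollision A ds S
  noCollision-∷-≤ d ds S = ℚ.≤-trans (ℚ.≤-reflexive (noCollision-↭ A (∷↭∷ʳ d ds) S))
                                     (noCollision-++-≤ ds (d ∷ []) S)

-- Lower bound for an arbitrary algorithm

χ∈-yes : ∀ {x S} → x ∈ S → χ∈ x S ≡ 1ℚ
χ∈-yes {x} {S} x∈S = cong χ (dec-true (x ∈? S) x∈S)

χ∈-no : ∀ {x S} → x ∉ S → χ∈ x S ≡ 0ℚ
χ∈-no {x} {S} x∉S = cong χ (dec-false (x ∈? S) x∉S)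

χ∈-nonneg : ∀ x S → 0ℚ ℚ.≤ χ∈ x S
χ∈-nonneg x S = χ-nonneg (does (x ∈? S))

∑-cong-All : {B : Set} {f g : B → ℚ} {xs : List B} → All (λ x → f x ≡ g x) xs → ∑ xs f ≡ ∑ xs g
∑-cong-All []         = refl
∑-cong-All (eq ∷ eqs) = cong₂ ℚ._+_ eq (∑-cong-All eqs)

threshold-≤ : ∀ {t p} (t≤?p : Dec (t ℚ.≤ p)) → 0ℚ ℚ.≤ p → t ℚ.* χ (does t≤?p) ℚ.≤ p
threshold-≤ {t} (yes t≤p) 0≤p = ℚ.≤-trans (ℚ.≤-reflexive (ℚ.*-identityʳ t)) t≤p
threshold-≤ {t} (no  _)   0≤p = ℚ.≤-trans (ℚ.≤-reflexive (ℚ.*-zeroʳ t)) 0≤p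

-- Restricting to heavy IDs loses at most `t` per ID, because a light one has `p` below `t`.
≤-threshold : ∀ {t p} (t≤?p : Dec (t ℚ.≤ p)) → 0ℚ ℚ.≤ t → p ℚ.≤ p ℚ.* χ (does t≤?p) ℚ.+ t
≤-threshold {t} {p} (yes _)   0≤t = ≤-from-slack 0≤t (cong (ℚ._+ t) (sym (ℚ.*-identityʳ p)))
≤-threshold {t} {p} (no  t≰p) 0≤t = ℚ.≤-trans (ℚ.<⇒≤ (ℚ.≰⇒> t≰p))
  (ℚ.≤-reflexive (sym (trans (cong (ℚ._+ t) (ℚ.*-zeroʳ p)) (ℚ.+-identityˡ t))))

0≤½ : 0ℚ ℚ.≤ ½
0≤½ = ℚ.nonNegative⁻¹ ½

-- The share of a single ID in `load-grows`: `X` is membership in the used set, `Y` in the new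
-- prefix of length `d`, `U` in the enlarged set, `p` the occupancy and `h` the heavy indicator.
union-≤ : {X Y U : Set} (X? : Dec X) (Y? : Dec Y) (U? : Dec U) (t h : ℚ) {p : ℚ} →
          (X → ¬ Y) → (X → U) → (Y → U) → t ℚ.* h ℚ.≤ p → 0ℚ ℚ.≤ p →
          p ℚ.* χ (does X?) ℚ.+ t ℚ.* (χ (does Y?) ℚ.* h) ℚ.≤ p ℚ.* χ (does U?)
union-≤ (yes x) (yes y) _ _ _ ¬xy _ _ _ _ = ⊥-elim (¬xy x y)
union-≤ (yes x) _ (no ¬u) _ _ _ xu _ _ _ = ⊥-elim (¬u (xu x))
union-≤ _ (yes y) (no ¬u) _ _ _ _ yu _ _ = ⊥-elim (¬u (yu y))
union-≤ (yes _) (no _) (yes _) t h {p} _ _ _ _ _ =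
  ℚ.≤-reflexive (solve 3 (λ p t h → p :* con 1ℚ :+ t :* (con 0ℚ :* h) := p :* con 1ℚ) refl p t h)
union-≤ (no _) (yes _) (yes _) t h {p} _ _ _ th≤p _ = ≤-from-slack (slack th≤p)
  (solve 3 (λ p t h → (p :* con 0ℚ :+ t :* (con 1ℚ :* h)) :+ (p :- t :* h) := p :* con 1ℚ) refl p t h)
union-≤ (no _) (no _) U? t h {p} _ _ _ _ 0≤p = ≤-from-slack (*-nonneg 0≤p (χ-nonneg (does U?)))
  (solve 4 (λ p t h q → (p :* con 0ℚ :+ t :* (con 0ℚ :* h)) :+ q := q) refl p t h _)

-- A common ID refutes disjointness, so either `D` fails or the left side vanishes.
intersection-≤ : {X Y D : Set} (X? : Dec X) (Y? : Dec Y) (D? : Dec D) → (X → Y → ¬ D) →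
                 χ (does X?) ℚ.* χ (does Y?) ℚ.≤ (1ℚ ℚ.- χ (does D?)) ℚ.* χ (does X?)
intersection-≤ (yes x) (yes y) (yes d) ¬d = ⊥-elim (¬d x y d)
intersection-≤ (yes _) (yes _) (no _)  _  = ℚ.≤-refl
intersection-≤ (yes _) (no _)  (yes _) _  = ℚ.≤-refl
intersection-≤ (yes _) (no _)  (no _)  _  = ℚ.nonNegative⁻¹ 1ℚ
intersection-≤ (no _)  (yes _) (yes _) _  = ℚ.≤-refl
intersection-≤ (no _)  (yes _) (no _)  _  = ℚ.≤-refl
intersection-≤ (no _)  (no _)  (yes _) _  = ℚ.≤-refl
intersection-≤ (no _)  (no _)  (no _)  _  = ℚ.≤-refl

Unique-++⇒Disjoint : ∀ {xs ys : List ℕ} → Unique (xs ++ ys) → Disjoint xs ys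
Unique-++⇒Disjoint {x ∷ xs} (x∉ ∷ _)  (here refl , v∈ys)  = All.lookup x∉ (∈-++⁺ʳ xs v∈ys) refl
Unique-++⇒Disjoint {x ∷ xs} (_ ∷ xs!) (there v∈xs , v∈ys) = Unique-++⇒Disjoint xs! (v∈xs , v∈ys)

take-⊆ : ∀ {d e} {x : ℕ} o → d ≤ e → x ∈ take d o → x ∈ take e o
take-⊆ (y ∷ o) (ℕ.s≤s d≤e) (here x≡y) = here x≡y
take-⊆ (y ∷ o) (ℕ.s≤s d≤e) (there x∈) = there (take-⊆ o d≤e x∈)

-- An ordering is free of repetitions, so its first `d` entries are distinct and disjoint from the
-- remaining ones.
∑-prefix : ∀ {m d o} → o ↭ upTo m → d ≤ m → ∑ (upTo m) (λ x → χ∈ x (take d o)) ≡ ℕ→ℚ d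
∑-prefix {m} {d} {o} o↭ d≤m = begin
  ∑ (upTo m) in-prefix
    ≡⟨ ∑-↭ in-prefix o↭ ⟨
  ∑ o in-prefix
    ≡⟨ cong (λ l → ∑ l in-prefix) (take++drop≡id d o) ⟨
  ∑ (take d o ++ drop d o) in-prefix
    ≡⟨ ∑-++ in-prefix (take d o) (drop d o) ⟩
  ∑ (take d o) in-prefix ℚ.+ ∑ (drop d o) in-prefix
    ≡⟨ cong₂ ℚ._+_ (∑-cong-All (All.tabulate (χ∈-yes {S = take d o})))
                   (∑-cong-All (All.tabulate λ x∈drop → χ∈-no {S = take d o} λ x∈take → prefix#suffix (x∈take , x∈drop))) ⟩
  ∑ (take d o) (λ _ → 1ℚ) ℚ.+ ∑ (drop d o) (λ _ → 0ℚ)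
    ≡⟨ cong₂ ℚ._+_ (∑-const 1ℚ (take d o)) (∑-zero (drop d o)) ⟩
  ℕ→ℚ (length (take d o)) ℚ.* 1ℚ ℚ.+ 0ℚ
    ≡⟨ trans (ℚ.+-identityʳ _) (ℚ.*-identityʳ _) ⟩
  ℕ→ℚ (length (take d o))
    ≡⟨ cong ℕ→ℚ (trans (length-take d o) (ℕ.m≤n⇒m⊓n≡m (subst (d ≤_) (sym o-length) d≤m))) ⟩
  ℕ→ℚ d ∎
  where
  open ≡-Reasoning
  in-prefix : ℕ → ℚ
  in-prefix x = χ∈ x (take d o)
  o-length : length o ≡ m
  o-length = trans (↭-length o↭) (length-upTo m)
  prefix#suffix : Disjoint (take d o) (drop d o)
  prefix#suffix = Unique-++⇒Disjoint (subst Unique (sym (take++drop≡id d o))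
    (↭ₛ.Unique-resp-↭ (setoid ℕ) (↭.↭⇒↭ₛ (↭.↭-sym o↭)) (upTo⁺ m)))

-- Replaces the expected heavy count `z` by its lower bound δ/2: the correction κτδ/2 + τδ - τz
-- becomes at most (κ + 1)τδ/2, which leaves the factor n - 1/2.
snoc-combine : ∀ {P f κ⁺ τ} n κ δ z → κ⁺ ≡ 1ℚ ℚ.+ κ →
  P ℚ.≤ (((δ ℚ.- f) ℚ.- (κ ℚ.* (τ ℚ.* δ) ℚ.+ τ ℚ.* δ)) ℚ.* n ℚ.+ (ℚ.- τ) ℚ.* z) ℚ.+ (κ ℚ.* (τ ℚ.* δ) ℚ.* ½ ℚ.+ τ ℚ.* δ) →
  0ℚ ℚ.≤ τ → δ ℚ.≤ z ℚ.+ δ ℚ.* ½ →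
  P ℚ.+ (f ℚ.* n ℚ.+ κ⁺ ℚ.* (τ ℚ.* δ) ℚ.* (n ℚ.- ½)) ℚ.≤ δ ℚ.* n
snoc-combine {P} {f} {_} {τ} n κ δ z refl P≤ 0≤τ δ≤ =
  ≤-from-slack (+-nonneg (slack P≤) (*-nonneg 0≤τ (slack δ≤)))
    (solve 7 (λ P f n κ τ δ z →
      P :+ (f :* n :+ (con 1ℚ :+ κ) :* (τ :* δ) :* (n :- con ½))
        :+ (((((δ :- f) :- (κ :* (τ :* δ) :+ τ :* δ)) :* n :+ (:- τ) :* z) :+ (κ :* (τ :* δ) :* con ½ :+ τ :* δ) :- P)
            :+ τ :* (z :+ δ :* con ½ :- δ))
      := δ :* n) refl P f n κ τ δ z)

isDistribution : ∀ {m} (A : Algorithm m) → IsDistribution (support A)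
isDistribution A = record { weights-nonneg = nonneg A ; weights-sum = sums-to-one A }

-- Serving the instance of smallest demand last

module LastRequest {m} (A : Algorithm m) {d} (1≤d : 1 ≤ d) (d≤m : d ≤ m) where

  private
    W = support A
    dist = isDistribution A
    N = noCollision W
    δ = ℕ→ℚ d
    μ = ℕ→ℚ m

    instance
      μ-positive : ℚ.Positive μ
      μ-positive = ℕ→ℚ-positive (ℕ.≤-trans 1≤d d≤m)
      μ-nonZero : ℚ.NonZero μ
      μ-nonZero = ℚ.pos⇒nonZero μ
      δ-positive : ℚ.Positive δ
      δ-positive = ℕ→ℚ-positive 1≤d

  -- This is d / (2m): the light IDs, at most m of them, then carry at most d/2 of the total
  -- occupancy d.
  τ : ℚ
  τ = δ ℚ.* (½ ℚ.* ℚ.1/ μ)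

  μτ : μ ℚ.* τ ≡ δ ℚ.* ½
  μτ = trans (solve 4 (λ μ δ h i → μ :* (δ :* (h :* i)) := (δ :* h) :* (μ :* i)) refl μ δ ½ (ℚ.1/ μ))
             (trans (cong ((δ ℚ.* ½) ℚ.*_) (ℚ.*-inverseʳ μ)) (ℚ.*-identityʳ _))

  τ-nonneg : 0ℚ ℚ.≤ τ
  τ-nonneg = ℚ.*-cancelˡ-≤-pos μ (begin
    μ ℚ.* 0ℚ ≡⟨ ℚ.*-zeroʳ μ ⟩
    0ℚ       ≤⟨ *-nonneg (ℕ→ℚ-nonneg d) 0≤½ ⟩
    δ ℚ.* ½  ≡⟨ μτ ⟨
    μ ℚ.* τ  ∎)
    where open ℚ.≤-Reasoning

  occupancy : ℕ → ℚ
  occupancy x = 𝔼 W (λ o → χ∈ x (take d o))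

  occupancy-nonneg : ∀ x → 0ℚ ℚ.≤ occupancy x
  occupancy-nonneg x = begin
    0ℚ           ≡⟨ 𝔼-const dist 0ℚ ⟨
    𝔼 W (λ _ → 0ℚ) ≤⟨ 𝔼-mono-∀ dist (λ o → χ∈-nonneg x (take d o)) ⟩
    occupancy x  ∎
    where open ℚ.≤-Reasoning

  heavy : ℕ → Bool
  heavy x = does (τ ℚ.≤? occupancy x)

  τ-heavy : ∀ x → τ ℚ.* χ (heavy x) ℚ.≤ occupancy x
  τ-heavy x = threshold-≤ (τ ℚ.≤? occupancy x) (occupancy-nonneg x)

  occupancy-heavy : ∀ x → occupancy x ℚ.≤ occupancy x ℚ.* χ (heavy x) ℚ.+ τ
  occupancy-heavy x = ≤-threshold (τ ℚ.≤? occupancy x) τ-nonneg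

  -- After exchanging sum and expectation, the expected number of IDs of `S` among the first `d` of
  -- a draw.
  load : List ℕ → ℚ
  load S = ∑ (upTo m) (λ x → occupancy x ℚ.* χ∈ x S)

  heavyCount : List ℕ → ℚ
  heavyCount o = ∑ (upTo m) (λ x → χ∈ x (take d o) ℚ.* χ (heavy x))

  heavyCount≤d : ∀ {o} → o ↭ upTo m → heavyCount o ℚ.≤ δ
  heavyCount≤d {o} o↭ = ℚ.≤-trans
    (∑-mono (All.universal (λ x → ℚ.≤-trans (*-monoˡ (χ∈-nonneg x (take d o)) (χ≤1 (heavy x)))
                                             (ℚ.≤-reflexive (ℚ.*-identityʳ _))) (upTo m)))
    (ℚ.≤-reflexive (∑-prefix o↭ d≤m))

  ∑-occupancy : ∑ (upTo m) occupancy ≡ δ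
  ∑-occupancy = begin
    ∑ (upTo m) occupancy                              ≡⟨ ∑-𝔼-swap (λ x o → χ∈ x (take d o)) (upTo m) W ⟩
    𝔼 W (λ o → ∑ (upTo m) (λ x → χ∈ x (take d o)))  ≡⟨ ∑-cong-All (All.map (λ {wo} o↭ → cong (proj₁ wo ℚ.*_) (∑-prefix o↭ d≤m)) (orderings A)) ⟩
    𝔼 W (λ _ → δ)                                    ≡⟨ 𝔼-const dist δ ⟩
    δ ∎
    where open ≡-Reasoning

  -- The occupancies add up to `d`, and light IDs contribute at most mτ = d/2 of that.
  𝔼-heavyCount : δ ℚ.≤ 𝔼 W heavyCount ℚ.+ δ ℚ.* ½
  𝔼-heavyCount = begin
    δ                                                            ≡⟨ ∑-occupancy ⟨
    ∑ (upTo m) occupancy                                         ≤⟨ ∑-mono (All.universal occupancy-heavy (upTo m)) ⟩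
    ∑ (upTo m) (λ x → occupancy x ℚ.* χ (heavy x) ℚ.+ τ)         ≡⟨ ∑-+ (λ x → occupancy x ℚ.* χ (heavy x)) (λ _ → τ) (upTo m) ⟩
    ∑ (upTo m) (λ x → occupancy x ℚ.* χ (heavy x)) ℚ.+ ∑ (upTo m) (λ _ → τ) ≡⟨ cong₂ ℚ._+_ swapped total ⟩
    𝔼 W heavyCount ℚ.+ δ ℚ.* ½ ∎
    where
    open ℚ.≤-Reasoning
    swapped : ∑ (upTo m) (λ x → occupancy x ℚ.* χ (heavy x)) ≡ 𝔼 W heavyCount
    swapped = trans (∑-cong (λ x → sym (𝔼-*ʳ W (λ o → χ∈ x (take d o)) (χ (heavy x)))) (upTo m))
                    (∑-𝔼-swap (λ x o → χ∈ x (take d o) ℚ.* χ (heavy x)) (upTo m) W)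
    total : ∑ (upTo m) (λ _ → τ) ≡ δ ℚ.* ½
    total = trans (∑-const τ (upTo m)) (trans (cong (λ k → ℕ→ℚ k ℚ.* τ) (length-upTo m)) μτ)

  -- The first `d` IDs of the new prefix are new to `S`, and each heavy one among them adds at least
  -- τ.
  load-grows : ∀ {e S} o → d ≤ e → Disjoint (take e o) S →
               load S ℚ.+ τ ℚ.* heavyCount o ℚ.≤ load (take e o ++ S)
  load-grows {e} {S} o d≤e e#S = begin
    load S ℚ.+ τ ℚ.* heavyCount o
      ≡⟨ cong (load S ℚ.+_) (∑-*ˡ τ (λ x → χ∈ x (take d o) ℚ.* χ (heavy x)) (upTo m)) ⟨
    load S ℚ.+ ∑ (upTo m) (λ x → τ ℚ.* (χ∈ x (take d o) ℚ.* χ (heavy x)))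
      ≡⟨ ∑-+ (λ x → occupancy x ℚ.* χ∈ x S) (λ x → τ ℚ.* (χ∈ x (take d o) ℚ.* χ (heavy x))) (upTo m) ⟨
    ∑ (upTo m) (λ x → occupancy x ℚ.* χ∈ x S ℚ.+ τ ℚ.* (χ∈ x (take d o) ℚ.* χ (heavy x)))
      ≤⟨ ∑-mono (All.universal pointwise (upTo m)) ⟩
    load (take e o ++ S) ∎
    where
    open ℚ.≤-Reasoning
    pointwise : ∀ x → occupancy x ℚ.* χ∈ x S ℚ.+ τ ℚ.* (χ∈ x (take d o) ℚ.* χ (heavy x))
                      ℚ.≤ occupancy x ℚ.* χ∈ x (take e o ++ S)
    pointwise x = union-≤ (x ∈? S) (x ∈? take d o) (x ∈? (take e o ++ S)) τ (χ (heavy x))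
      (λ x∈S x∈o → e#S (take-⊆ o d≤e x∈o , x∈S)) (∈-++⁺ʳ (take e o)) (λ x∈o → ∈-++⁺ˡ (take-⊆ o d≤e x∈o))
      (τ-heavy x) (occupancy-nonneg x)

  -- A draw shares no ID with `S` if the two are disjoint and at most `d` otherwise, while the
  -- expected number shared is `load S`.
  noCollision-[d] : ∀ S → δ ℚ.* N (d ∷ []) S ℚ.+ load S ℚ.≤ δ
  noCollision-[d] S = begin
    δ ℚ.* N (d ∷ []) S ℚ.+ load S
      ≡⟨ cong₂ ℚ._+_ scaled swapped ⟩
    𝔼 W (λ o → δ ℚ.* χdisj (take d o) S) ℚ.+ 𝔼 W shared
      ≡⟨ 𝔼-+ W (λ o → δ ℚ.* χdisj (take d o) S) shared ⟨
    𝔼 W (λ o → δ ℚ.* χdisj (take d o) S ℚ.+ shared o)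
      ≤⟨ 𝔼-mono dist (All.map (λ {wo} → pointwise wo) (orderings A)) ⟩
    𝔼 W (λ _ → δ)
      ≡⟨ 𝔼-const dist δ ⟩
    δ ∎
    where
    open ℚ.≤-Reasoning
    shared : List ℕ → ℚ
    shared o = ∑ (upTo m) (λ x → χ∈ x (take d o) ℚ.* χ∈ x S)
    scaled : δ ℚ.* N (d ∷ []) S ≡ 𝔼 W (λ o → δ ℚ.* χdisj (take d o) S)
    scaled = trans (cong (δ ℚ.*_) (trans (noCollision-∷ W d [] S) (𝔼-cong W λ o → ℚ.*-identityʳ (χdisj (take d o) S))))
                   (sym (𝔼-*ˡ W δ (λ o → χdisj (take d o) S)))
    swapped : load S ≡ 𝔼 W shared
    swapped = trans (∑-cong (λ x → sym (𝔼-*ʳ W (λ o → χ∈ x (take d o)) (χ∈ x S))) (upTo m))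
                    (∑-𝔼-swap (λ x o → χ∈ x (take d o) ℚ.* χ∈ x S) (upTo m) W)
    common : ∀ o x → χ∈ x (take d o) ℚ.* χ∈ x S ℚ.≤ (1ℚ ℚ.- χdisj (take d o) S) ℚ.* χ∈ x (take d o)
    common o x = intersection-≤ (x ∈? take d o) (x ∈? S) (disjoint? (take d o) S)
      (λ x∈o x∈S o#S → o#S (x∈o , x∈S))
    pointwise : ∀ wo → proj₂ wo ↭ upTo m →
      δ ℚ.* χdisj (take d (proj₂ wo)) S ℚ.+ shared (proj₂ wo) ℚ.≤ δ
    pointwise (_ , o) o↭ = begin
      δ ℚ.* c ℚ.+ shared o
        ≤⟨ ℚ.+-monoʳ-≤ (δ ℚ.* c) (∑-mono (All.universal (common o) (upTo m))) ⟩
      δ ℚ.* c ℚ.+ ∑ (upTo m) (λ x → (1ℚ ℚ.- c) ℚ.* χ∈ x (take d o))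
        ≡⟨ cong (δ ℚ.* c ℚ.+_) (trans (∑-*ˡ (1ℚ ℚ.- c) (λ x → χ∈ x (take d o)) (upTo m))
                                        (cong ((1ℚ ℚ.- c) ℚ.*_) (∑-prefix o↭ d≤m))) ⟩
      δ ℚ.* c ℚ.+ (1ℚ ℚ.- c) ℚ.* δ
        ≡⟨ solve 2 (λ δ c → δ :* c :+ (con 1ℚ :- c) :* δ := δ) refl δ c ⟩
      δ ∎
      where
      c : ℚ
      c = χdisj (take d o) S

  -- The core of the lower bound, by induction on `ds` with `S` arbitrary. Write n for `N ds S`.
  -- Each instance of `ds` has on average at least d/2 heavy IDs among its first `d`, and colliding
  -- runs, of probability 1 - n, account for at most d(1 - n) of them. Surviving runs thus keep at
  -- least d(n - 1/2), each worth τ. Together with `load S` this bounds the expected overlap with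
  -- the last draw from below.
  noCollision-snoc : ∀ {ds} → All (d ≤_) ds → ∀ S →
    δ ℚ.* N (ds ++ d ∷ []) S ℚ.+ (load S ℚ.* N ds S ℚ.+ ℕ→ℚ (length ds) ℚ.* (τ ℚ.* δ) ℚ.* (N ds S ℚ.- ½))
      ℚ.≤ δ ℚ.* N ds S
  noCollision-snoc [] S = begin
    δ ℚ.* N (d ∷ []) S ℚ.+ (load S ℚ.* 1ℚ ℚ.+ 0ℚ ℚ.* (τ ℚ.* δ) ℚ.* (1ℚ ℚ.- ½))
      ≡⟨ solve 4 (λ a l t x → a :+ (l :* con 1ℚ :+ con 0ℚ :* t :* x) := a :+ l) refl (δ ℚ.* N (d ∷ []) S) (load S) (τ ℚ.* δ) (1ℚ ℚ.- ½) ⟩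
    δ ℚ.* N (d ∷ []) S ℚ.+ load S
      ≤⟨ noCollision-[d] S ⟩
    δ
      ≡⟨ ℚ.*-identityʳ δ ⟨
    δ ℚ.* 1ℚ ∎
    where open ℚ.≤-Reasoning
  noCollision-snoc {e ∷ ds} (d≤e ∷ d≤ds) S =
    snoc-combine n κ δ (𝔼 W heavyCount) (ℕ→ℚ-+ 1 (length ds)) averaged τ-nonneg 𝔼-heavyCount
    where
    f n κ P a b r : ℚ
    f = load S
    n = N (e ∷ ds) S
    κ = ℕ→ℚ (length ds)
    P = δ ℚ.* N (e ∷ ds ++ d ∷ []) S
    -- Coefficients of a bound that is affine in `c` times `n′` and in the heavy count, so that
    -- averaging needs only these two expectations.
    a = (δ ℚ.- f) ℚ.- (κ ℚ.* (τ ℚ.* δ) ℚ.+ τ ℚ.* δ)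
    b = ℚ.- τ
    r = κ ℚ.* (τ ℚ.* δ) ℚ.* ½ ℚ.+ τ ℚ.* δ

    c n′ P′ : List ℕ → ℚ
    c o = χdisj (take e o) S
    n′ o = N ds (take e o ++ S)
    P′ o = N (ds ++ d ∷ []) (take e o ++ S)

    τδ-nonneg : 0ℚ ℚ.≤ τ ℚ.* δ
    τδ-nonneg = *-nonneg τ-nonneg (ℕ→ℚ-nonneg d)

    pointwise : ∀ wo → proj₂ wo ↭ upTo m →
      δ ℚ.* (c (proj₂ wo) ℚ.* P′ (proj₂ wo)) ℚ.≤ (a ℚ.* (c (proj₂ wo) ℚ.* n′ (proj₂ wo)) ℚ.+ b ℚ.* heavyCount (proj₂ wo)) ℚ.+ r
    pointwise (_ , o) o↭ = by-cases (disjoint? (take e o) S)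
      where
      by-cases : (disj? : Dec (Disjoint (take e o) S)) →
        δ ℚ.* (χ (does disj?) ℚ.* P′ o) ℚ.≤ (a ℚ.* (χ (does disj?) ℚ.* n′ o) ℚ.+ b ℚ.* heavyCount o) ℚ.+ r
      -- A colliding draw leaves 0 on the left; on the right r - τz is nonnegative since z ≤ δ.
      by-cases (no _) =
        ≤-from-slack (+-nonneg (*-nonneg (*-nonneg (ℕ→ℚ-nonneg (length ds)) τδ-nonneg) 0≤½)
                               (*-nonneg τ-nonneg (slack (heavyCount≤d o↭))))
          (solve 7 (λ P f n κ τ δ z →
            δ :* (con 0ℚ :* P) :+ (κ :* (τ :* δ) :* con ½ :+ τ :* (δ :- z))
            := (((δ :- f) :- (κ :* (τ :* δ) :+ τ :* δ)) :* (con 0ℚ :* n) :+ (:- τ) :* z) :+ (κ :* (τ :* δ) :* con ½ :+ τ :* δ))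
            refl (P′ o) f (n′ o) κ τ δ (heavyCount o))
      -- Three ingredients: the induction hypothesis at the enlarged used set, the growth of the
      -- load weighted by n′, and (1 - n′)(δ - z) ≥ 0. The last says n′z ≥ z - (1 - n′)δ, which
      -- decouples survival from the heavy count.
      by-cases (yes disj) =
        ≤-from-slack (+-nonneg (+-nonneg (slack (noCollision-snoc d≤ds (take e o ++ S)))
                                         (*-nonneg (noCollision-nonneg dist ds (take e o ++ S)) (slack (load-grows o d≤e disj))))
                               (*-nonneg τ-nonneg (*-nonneg (slack (noCollision≤1 dist ds (take e o ++ S))) (slack (heavyCount≤d o↭)))))
          (solve 8 (λ P f n κ τ δ z f′ →
            δ :* (con 1ℚ :* P)
              :+ (((δ :* n :- (δ :* P :+ (f′ :* n :+ κ :* (τ :* δ) :* (n :- con ½))))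
                   :+ n :* (f′ :- (f :+ τ :* z)))
                  :+ τ :* ((con 1ℚ :- n) :* (δ :- z)))
            := (((δ :- f) :- (κ :* (τ :* δ) :+ τ :* δ)) :* (con 1ℚ :* n) :+ (:- τ) :* z) :+ (κ :* (τ :* δ) :* con ½ :+ τ :* δ))
            refl (P′ o) f (n′ o) κ τ δ (heavyCount o) (load (take e o ++ S)))

    averaged : P ℚ.≤ (a ℚ.* n ℚ.+ b ℚ.* 𝔼 W heavyCount) ℚ.+ r
    averaged = begin
      P
        ≡⟨ cong (δ ℚ.*_) (noCollision-∷ W e (ds ++ d ∷ []) S) ⟩
      δ ℚ.* 𝔼 W (λ o → c o ℚ.* P′ o)
        ≡⟨ 𝔼-*ˡ W δ (λ o → c o ℚ.* P′ o) ⟨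
      𝔼 W (λ o → δ ℚ.* (c o ℚ.* P′ o))
        ≤⟨ 𝔼-mono dist (All.map (λ {wo} → pointwise wo) (orderings A)) ⟩
      𝔼 W (λ o → (a ℚ.* (c o ℚ.* n′ o) ℚ.+ b ℚ.* heavyCount o) ℚ.+ r)
        ≡⟨ 𝔼-affine dist a b r (λ o → c o ℚ.* n′ o) heavyCount ⟩
      (a ℚ.* 𝔼 W (λ o → c o ℚ.* n′ o) ℚ.+ b ℚ.* 𝔼 W heavyCount) ℚ.+ r
        ≡⟨ cong (λ n → (a ℚ.* n ℚ.+ b ℚ.* 𝔼 W heavyCount) ℚ.+ r) (noCollision-∷ W e ds S) ⟨
      (a ℚ.* n ℚ.+ b ℚ.* 𝔼 W heavyCount) ℚ.+ r ∎
      where open ℚ.≤-Reasoning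

-- On an ascending list the head is the minimum of each pair it belongs to, so this is the sum of
-- min(dᵢ, dⱼ) over all pairs.
pairDemand : List ℕ → ℕ
pairDemand []       = 0
pairDemand (d ∷ ds) = length ds * d ℕ.+ pairDemand ds

¾ : ℚ
¾ = ½ ℚ.+ ½ ℚ.* ½

-- Since n ≥ 3/4, the factor n - 1/2 is at least 1/4. With τ = δ/(2μ) the new instance adds at least
-- κδ/(8μ) to the collision probability, whence the 8.
lower-combine : ∀ {N′ l κ τ δ} x n μ → l ≡ 0ℚ → μ ℚ.* τ ≡ δ ℚ.* ½ →
  0ℚ ℚ.≤ μ → 0ℚ ℚ.≤ δ → 0ℚ ℚ.≤ κ → ¾ ℚ.≤ n →
  δ ℚ.* N′ ℚ.+ (l ℚ.* n ℚ.+ κ ℚ.* (τ ℚ.* δ) ℚ.* (n ℚ.- ½)) ℚ.≤ δ ℚ.* n →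
  x ℚ.≤ (ℕ→ℚ 8 ℚ.* μ) ℚ.* (1ℚ ℚ.- n) →
  δ ℚ.* (κ ℚ.* δ ℚ.+ x) ℚ.≤ δ ℚ.* ((ℕ→ℚ 8 ℚ.* μ) ℚ.* (1ℚ ℚ.- N′))
lower-combine {N′} {_} {κ} {τ} {δ} x n μ refl μτ 0≤μ 0≤δ 0≤κ ¾≤n step ih =
  ≤-from-slack
    (+-nonneg (+-nonneg (+-nonneg (*-nonneg (*-nonneg (ℕ→ℚ-nonneg 8) 0≤μ) (slack step))
                                  (*-nonneg 0≤δ (slack ih)))
                        (*-nonneg (*-nonneg (ℕ→ℚ-nonneg 4) (*-nonneg κδ-nonneg 0≤δ)) (slack ¾≤n)))
              -- This summand equals 0; it brings μτ = δ/2 into the ring identity, as the solver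
              -- sees no hypotheses.
              (ℚ.≤-reflexive (sym (trans (cong (λ t → ℕ→ℚ 8 ℚ.* (κ ℚ.* δ) ℚ.* (n ℚ.- ½) ℚ.* (t ℚ.- δ ℚ.* ½)) μτ)
                                  (solve 4 (λ κ δ n h → con (ℕ→ℚ 8) :* (κ :* δ) :* (n :- h) :* (δ :* h :- δ :* h) := con 0ℚ) refl κ δ n ½)))))
    (solve 7 (λ N′ κ τ δ x n μ →
      δ :* (κ :* δ :+ x)
        :+ ((con (ℕ→ℚ 8) :* μ :* (δ :* n :- (δ :* N′ :+ (con 0ℚ :* n :+ κ :* (τ :* δ) :* (n :- con ½))))
             :+ δ :* (con (ℕ→ℚ 8) :* μ :* (con 1ℚ :- n) :- x)
             :+ con (ℕ→ℚ 4) :* (κ :* δ :* δ) :* (n :- con ¾))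
            :+ con (ℕ→ℚ 8) :* (κ :* δ) :* (n :- con ½) :* (μ :* τ :- δ :* con ½))
      := δ :* (con (ℕ→ℚ 8) :* μ :* (con 1ℚ :- N′))) refl N′ κ τ δ x n μ)
  where
  κδ-nonneg : 0ℚ ℚ.≤ κ ℚ.* δ
  κδ-nonneg = *-nonneg 0≤κ 0≤δ

-- The head of an ascending list is moved to the end and plays the last instance. Once the
-- no-collision probability is at most 3/4 it stays so as instances are added; until then each new
-- instance contributes its term of `pairDemand`.
noCollision-upper : ∀ {m} (A : Algorithm m) {ds} → AllPairs _≤_ ds → All (λ d → 1 ≤ d × d ≤ m) ds →
  noCollision (support A) ds [] ℚ.≤ ¾
  ⊎ ℕ→ℚ (pairDemand ds) ℚ.≤ (ℕ→ℚ 8 ℚ.* ℕ→ℚ m) ℚ.* (1ℚ ℚ.- noCollision (support A) ds [])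
noCollision-upper {m} A [] [] = inj₂ (ℚ.≤-reflexive (sym (ℚ.*-zeroʳ (ℕ→ℚ 8 ℚ.* ℕ→ℚ m))))
noCollision-upper {m} A {d ∷ ds} (d≤ds ∷ sorted) ((1≤d , d≤m) ∷ bounds)
  with noCollision-upper A sorted bounds | ℚ.≤-total (noCollision (support A) ds []) ¾
... | inj₁ n≤¾ | _ = inj₁ (ℚ.≤-trans (noCollision-∷-≤ (isDistribution A) d ds []) n≤¾)
... | inj₂ _ | inj₁ n≤¾ = inj₁ (ℚ.≤-trans (noCollision-∷-≤ (isDistribution A) d ds []) n≤¾)
... | inj₂ ih | inj₂ ¾≤n = inj₂ (begin
  ℕ→ℚ (length ds * d ℕ.+ pairDemand ds)
    ≡⟨ trans (ℕ→ℚ-+ (length ds * d) (pairDemand ds)) (cong (ℚ._+ ℕ→ℚ (pairDemand ds)) (ℕ→ℚ-* (length ds) d)) ⟩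
  ℕ→ℚ (length ds) ℚ.* ℕ→ℚ d ℚ.+ ℕ→ℚ (pairDemand ds)
    ≤⟨ ℚ.*-cancelˡ-≤-pos (ℕ→ℚ d) {{ℕ→ℚ-positive 1≤d}}
         (lower-combine (ℕ→ℚ (pairDemand ds)) (noCollision (support A) ds []) (ℕ→ℚ m) load-[] μτ
           (ℕ→ℚ-nonneg m) (ℕ→ℚ-nonneg d) (ℕ→ℚ-nonneg (length ds)) ¾≤n (noCollision-snoc d≤ds []) ih) ⟩
  (ℕ→ℚ 8 ℚ.* ℕ→ℚ m) ℚ.* (1ℚ ℚ.- noCollision (support A) (ds ++ d ∷ []) [])
    ≡⟨ cong (λ p → (ℕ→ℚ 8 ℚ.* ℕ→ℚ m) ℚ.* (1ℚ ℚ.- p)) (noCollision-↭ (support A) (∷↭∷ʳ d ds) []) ⟨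
  (ℕ→ℚ 8 ℚ.* ℕ→ℚ m) ℚ.* (1ℚ ℚ.- noCollision (support A) (d ∷ ds) []) ∎)
  where
  open ℚ.≤-Reasoning
  open LastRequest A 1≤d d≤m
  load-[] : load [] ≡ 0ℚ
  load-[] = trans (∑-cong (λ x → ℚ.*-zeroʳ (occupancy x)) (upTo m)) (∑-zero (upTo m))

-- Union bound

meet-++ : ∀ xs T S → 1ℚ ℚ.- χdisj xs (T ++ S) ℚ.≤ (1ℚ ℚ.- χdisj xs T) ℚ.+ (1ℚ ℚ.- χdisj xs S)
meet-++ xs T S = by-cases (disjoint? xs (T ++ S)) (disjoint? xs T) (disjoint? xs S)
  λ xs#T xs#S (v∈xs , v∈TS) → [ (λ v∈T → xs#T (v∈xs , v∈T)) , (λ v∈S → xs#S (v∈xs , v∈S)) ]′ (∈-++⁻ T v∈TS)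
  where
  by-cases : {U X Y : Set} (U? : Dec U) (X? : Dec X) (Y? : Dec Y) → (X → Y → U) →
    1ℚ ℚ.- χ (does U?) ℚ.≤ (1ℚ ℚ.- χ (does X?)) ℚ.+ (1ℚ ℚ.- χ (does Y?))
  by-cases (yes _) X? Y? _ = +-nonneg (slack (χ≤1 (does X?))) (slack (χ≤1 (does Y?)))
  by-cases (no ¬u) (yes x) (yes y) xyu = ⊥-elim (¬u (xyu x y))
  by-cases (no _) (no _) Y? _ = ≤-from-slack (slack (χ≤1 (does Y?))) refl
  by-cases (no _) (yes _) (no _) _ = ℚ.≤-refl

module UnionBound {W : Weighted (List ℕ)} (dist : IsDistribution W) where

  meetProb : ℕ → List ℕ → ℚ
  meetProb e S = 𝔼 W (λ o → 1ℚ ℚ.- χdisj (take e o) S)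

  meetProb-++ : ∀ e T S → meetProb e (T ++ S) ℚ.≤ meetProb e T ℚ.+ meetProb e S
  meetProb-++ e T S = ℚ.≤-trans (𝔼-mono-∀ dist (λ o → meet-++ (take e o) T S))
    (ℚ.≤-reflexive (𝔼-+ W (λ o → 1ℚ ℚ.- χdisj (take e o) T) (λ o → 1ℚ ℚ.- χdisj (take e o) S)))

  meetProb-[] : ∀ e → meetProb e [] ≡ 0ℚ
  meetProb-[] e = trans (𝔼-cong W (λ o → cong (λ b → 1ℚ ℚ.- χ b) (dec-true (disjoint? (take e o) []) λ { (_ , ()) })))
                        (𝔼-const dist 0ℚ)

  ∑-meetProb-[] : ∀ ds → ∑ ds (λ e → meetProb e []) ≡ 0ℚ
  ∑-meetProb-[] ds = trans (∑-cong meetProb-[] ds) (∑-zero ds)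

  module _ (κ : ℚ) (allowed : ℕ → Set)
    (meetProb-prefix : ∀ {d e} → allowed d → allowed e → All (λ wo → meetProb e (take d (proj₂ wo)) ℚ.≤ κ ℚ.* ℕ→ℚ d) W)
    where

    ∑-meetProb-prefix : ∀ {d} ds → allowed d → All allowed ds → ∀ S →
      All (λ wo → ∑ ds (λ e → meetProb e (take d (proj₂ wo) ++ S))
                  ℚ.≤ ℕ→ℚ (length ds) ℚ.* (κ ℚ.* ℕ→ℚ d) ℚ.+ ∑ ds (λ e → meetProb e S)) W
    ∑-meetProb-prefix {d} ds ok-d ok-ds S = All.tabulate λ {wo} wo∈W → begin
      ∑ ds (λ e → meetProb e (take d (proj₂ wo) ++ S))
        ≤⟨ ∑-mono (All.map (λ {e} ok-e → ℚ.≤-trans (meetProb-++ e (take d (proj₂ wo)) S)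
                             (ℚ.+-monoˡ-≤ (meetProb e S) (All.lookup (meetProb-prefix ok-d ok-e) wo∈W))) ok-ds) ⟩
      ∑ ds (λ e → κ ℚ.* ℕ→ℚ d ℚ.+ meetProb e S)
        ≡⟨ ∑-+ (λ _ → κ ℚ.* ℕ→ℚ d) (λ e → meetProb e S) ds ⟩
      ∑ ds (λ _ → κ ℚ.* ℕ→ℚ d) ℚ.+ ∑ ds (λ e → meetProb e S)
        ≡⟨ cong (ℚ._+ ∑ ds (λ e → meetProb e S)) (∑-const (κ ℚ.* ℕ→ℚ d) ds) ⟩
      ℕ→ℚ (length ds) ℚ.* (κ ℚ.* ℕ→ℚ d) ℚ.+ ∑ ds (λ e → meetProb e S) ∎
      where open ℚ.≤-Reasoning

    -- An instance with demand `d` is charged for hitting `S` and, with κd each, for the later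
    -- instances hitting its prefix; the latter charges add up to κ times `pairDemand`. `S` is
    -- general because it grows along the recursion.
    collision-union-bound : ∀ {ds} → All allowed ds → ∀ S →
      1ℚ ℚ.- noCollision W ds S ℚ.≤ ∑ ds (λ e → meetProb e S) ℚ.+ κ ℚ.* ℕ→ℚ (pairDemand ds)
    collision-union-bound [] S = ℚ.≤-reflexive (sym (trans (ℚ.+-identityˡ _) (ℚ.*-zeroʳ κ)))
    collision-union-bound {d ∷ ds} (ok-d ∷ ok-ds) S = begin
      1ℚ ℚ.- noCollision W (d ∷ ds) S
        ≡⟨ cong (λ p → 1ℚ ℚ.- p) (noCollision-∷ W d ds S) ⟩
      1ℚ ℚ.- 𝔼 W (λ o → c o ℚ.* n o)
        ≡⟨ solve 1 (λ x → con 1ℚ :- x := con 1ℚ :+ :- con 1ℚ :* x) refl (𝔼 W (λ o → c o ℚ.* n o)) ⟩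
      1ℚ ℚ.+ (ℚ.- 1ℚ) ℚ.* 𝔼 W (λ o → c o ℚ.* n o)
        ≡⟨ cong₂ ℚ._+_ (𝔼-const dist 1ℚ) (𝔼-*ˡ W (ℚ.- 1ℚ) (λ o → c o ℚ.* n o)) ⟨
      𝔼 W (λ _ → 1ℚ) ℚ.+ 𝔼 W (λ o → (ℚ.- 1ℚ) ℚ.* (c o ℚ.* n o))
        ≡⟨ 𝔼-+ W (λ _ → 1ℚ) (λ o → (ℚ.- 1ℚ) ℚ.* (c o ℚ.* n o)) ⟨
      𝔼 W (λ o → 1ℚ ℚ.+ (ℚ.- 1ℚ) ℚ.* (c o ℚ.* n o))
        ≤⟨ 𝔼-mono dist (All.map (λ {wo} → pointwise wo) (∑-meetProb-prefix ds ok-d ok-ds S)) ⟩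
      𝔼 W (λ o → (1ℚ ℚ.- c o) ℚ.+ (ρ ℚ.+ σ ℚ.+ κ ℚ.* x))
        ≡⟨ 𝔼-+ W (λ o → 1ℚ ℚ.- c o) (λ _ → ρ ℚ.+ σ ℚ.+ κ ℚ.* x) ⟩
      meetProb d S ℚ.+ 𝔼 W (λ _ → ρ ℚ.+ σ ℚ.+ κ ℚ.* x)
        ≡⟨ cong (meetProb d S ℚ.+_) (𝔼-const dist (ρ ℚ.+ σ ℚ.+ κ ℚ.* x)) ⟩
      meetProb d S ℚ.+ (ρ ℚ.+ σ ℚ.+ κ ℚ.* x)
        ≡⟨ solve 6 (λ p l κ δ σ x → p :+ (l :* (κ :* δ) :+ σ :+ κ :* x) := p :+ σ :+ κ :* (l :* δ :+ x)) refl
             (meetProb d S) (ℕ→ℚ (length ds)) κ (ℕ→ℚ d) σ x ⟩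
      meetProb d S ℚ.+ σ ℚ.+ κ ℚ.* (ℕ→ℚ (length ds) ℚ.* ℕ→ℚ d ℚ.+ x)
        ≡⟨ cong (λ y → meetProb d S ℚ.+ σ ℚ.+ κ ℚ.* y)
             (trans (ℕ→ℚ-+ (length ds * d) (pairDemand ds)) (cong (ℚ._+ x) (ℕ→ℚ-* (length ds) d))) ⟨
      meetProb d S ℚ.+ σ ℚ.+ κ ℚ.* ℕ→ℚ (pairDemand (d ∷ ds)) ∎
      where
      open ℚ.≤-Reasoning
      c n : List ℕ → ℚ
      c o = χdisj (take d o) S
      n o = noCollision W ds (take d o ++ S)
      ρ σ x : ℚ
      ρ = ℕ→ℚ (length ds) ℚ.* (κ ℚ.* ℕ→ℚ d)
      σ = ∑ ds (λ e → meetProb e S)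
      x = ℕ→ℚ (pairDemand ds)
      pointwise : ∀ wo → ∑ ds (λ e → meetProb e (take d (proj₂ wo) ++ S)) ℚ.≤ ρ ℚ.+ σ →
        1ℚ ℚ.+ (ℚ.- 1ℚ) ℚ.* (c (proj₂ wo) ℚ.* n (proj₂ wo)) ℚ.≤ (1ℚ ℚ.- c (proj₂ wo)) ℚ.+ (ρ ℚ.+ σ ℚ.+ κ ℚ.* x)
      pointwise (_ , o) ∑≤ = begin
        1ℚ ℚ.+ (ℚ.- 1ℚ) ℚ.* (c o ℚ.* n o)
          -- 1 - cn ≤ (1 - c) + (1 - n), because (1 - c)(1 - n) ≥ 0.
          ≤⟨ ≤-from-slack (*-nonneg (slack (χ≤1 (disjointᵇ (take d o) S))) (slack (noCollision≤1 dist ds (take d o ++ S))))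
               (solve 2 (λ c n → con 1ℚ :+ (:- con 1ℚ) :* (c :* n) :+ (con 1ℚ :- c) :* (con 1ℚ :- n) := (con 1ℚ :- c) :+ (con 1ℚ :- n))
                 refl (c o) (n o)) ⟩
        (1ℚ ℚ.- c o) ℚ.+ (1ℚ ℚ.- n o)
          ≤⟨ ℚ.+-monoʳ-≤ (1ℚ ℚ.- c o) (collision-union-bound ok-ds (take d o ++ S)) ⟩
        (1ℚ ℚ.- c o) ℚ.+ (∑ ds (λ e → meetProb e (take d o ++ S)) ℚ.+ κ ℚ.* x)
          ≤⟨ ℚ.+-monoʳ-≤ (1ℚ ℚ.- c o) (ℚ.+-monoˡ-≤ (κ ℚ.* x) ∑≤) ⟩
        (1ℚ ℚ.- c o) ℚ.+ (ρ ℚ.+ σ ℚ.+ κ ℚ.* x) ∎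

-- Bins of a random instance

∑-map : {B C : Set} (f : C → ℚ) (g : B → C) (xs : List B) → ∑ (map g xs) f ≡ ∑ xs (f ∘ g)
∑-map f g xs = cong sumℚ (sym (map-∘ xs))

∑-concatMap : {B C : Set} (f : C → ℚ) (g : B → List C) (xs : List B) →
              ∑ (concatMap g xs) f ≡ ∑ xs (λ x → ∑ (g x) f)
∑-concatMap f g []       = refl
∑-concatMap f g (x ∷ xs) =
  trans (∑-++ f (g x) (concatMap g xs)) (cong (∑ (g x) f ℚ.+_) (∑-concatMap f g xs))

∑-choices : (f : List ℕ → ℚ) (r : ℕ) (rs : List ℕ) →
            ∑ (choices (r ∷ rs)) f ≡ ∑ (upTo r) (λ j → ∑ (choices rs) (λ js → f (j ∷ js)))
∑-choices f r rs = trans (∑-concatMap f (λ j → map (j ∷_) (choices rs)) (upTo r))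
                         (∑-cong (λ j → ∑-map f (j ∷_) (choices rs)) (upTo r))

∑-upTo-const : ∀ r c → ∑ (upTo r) (λ _ → c) ≡ ℕ→ℚ r ℚ.* c
∑-upTo-const r c = trans (∑-const c (upTo r)) (cong (λ n → ℕ→ℚ n ℚ.* c) (length-upTo r))

numChoices : List ℕ → ℚ
numChoices rs = ∑ (choices rs) (λ _ → 1ℚ)

numChoices-∷ : ∀ r rs → numChoices (r ∷ rs) ≡ ℕ→ℚ r ℚ.* numChoices rs
numChoices-∷ r rs = trans (∑-choices (λ _ → 1ℚ) r rs) (∑-upTo-const r (numChoices rs))

numChoices-nonneg : ∀ rs → 0ℚ ℚ.≤ numChoices rs
numChoices-nonneg []       = ℚ.nonNegative⁻¹ 1ℚ
numChoices-nonneg (r ∷ rs) = ℚ.≤-trans (*-nonneg (ℕ→ℚ-nonneg r) (numChoices-nonneg rs))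
                                        (ℚ.≤-reflexive (sym (numChoices-∷ r rs)))

pow½-nonneg : ∀ n → 0ℚ ℚ.≤ powℚ ½ n
pow½-nonneg zero    = ℚ.nonNegative⁻¹ 1ℚ
pow½-nonneg (suc n) = *-nonneg 0≤½ (pow½-nonneg n)

pow½-cancel : ∀ n → powℚ ½ n ℚ.* ℕ→ℚ (2 ^ n) ≡ 1ℚ
pow½-cancel zero    = refl
pow½-cancel (suc n) = begin
  ½ ℚ.* powℚ ½ n ℚ.* ℕ→ℚ (2 * 2 ^ n)           ≡⟨ cong (½ ℚ.* powℚ ½ n ℚ.*_) (ℕ→ℚ-* 2 (2 ^ n)) ⟩
  ½ ℚ.* powℚ ½ n ℚ.* (ℕ→ℚ 2 ℚ.* ℕ→ℚ (2 ^ n))   ≡⟨ solve 2 (λ p q → con ½ :* p :* (con (ℕ→ℚ 2) :* q) := p :* q) refl (powℚ ½ n) (ℕ→ℚ (2 ^ n)) ⟩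
  powℚ ½ n ℚ.* ℕ→ℚ (2 ^ n)                      ≡⟨ pow½-cancel n ⟩
  1ℚ                                            ∎
  where open ≡-Reasoning

-- Every range is a power of two, so the number of choices is 2 to the sum of the exponents, the
-- reciprocal of the weight.
weight-numChoices : ∀ es → powℚ ½ (foldr ℕ._+_ 0 es) ℚ.* numChoices (map (2 ^_) es) ≡ 1ℚ
weight-numChoices es = trans (cong (powℚ ½ (foldr ℕ._+_ 0 es) ℚ.*_) (count es)) (pow½-cancel (foldr ℕ._+_ 0 es))
  where
  count : ∀ es → numChoices (map (2 ^_) es) ≡ ℕ→ℚ (2 ^ foldr ℕ._+_ 0 es)
  count []       = refl
  count (e ∷ es) = begin
    numChoices (2 ^ e ∷ map (2 ^_) es)                ≡⟨ numChoices-∷ (2 ^ e) (map (2 ^_) es) ⟩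
    ℕ→ℚ (2 ^ e) ℚ.* numChoices (map (2 ^_) es)        ≡⟨ cong (ℕ→ℚ (2 ^ e) ℚ.*_) (count es) ⟩
    ℕ→ℚ (2 ^ e) ℚ.* ℕ→ℚ (2 ^ foldr ℕ._+_ 0 es)        ≡⟨ ℕ→ℚ-* (2 ^ e) (2 ^ foldr ℕ._+_ 0 es) ⟨
    ℕ→ℚ (2 ^ e * 2 ^ foldr ℕ._+_ 0 es)                ≡⟨ cong ℕ→ℚ (ℕ.^-distribˡ-+-* 2 e (foldr ℕ._+_ 0 es)) ⟨
    ℕ→ℚ (2 ^ (e ℕ.+ foldr ℕ._+_ 0 es))                ∎
    where open ≡-Reasoning

binsWeight-numChoices : ∀ C → binsWeight C ℚ.* numChoices (binRanges C) ≡ 1ℚ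
binsWeight-numChoices C = trans (cong (λ rs → binsWeight C ℚ.* numChoices rs) (map-∘ (upTo C)))
                                (weight-numChoices (map (λ k → C ∸ suc k) (upTo C)))

𝔼-binsSupport : ∀ m f → 𝔼 (binsSupport m) f ≡ binsWeight (binsC m) ℚ.* ∑ (choices (binRanges (binsC m))) (f ∘ binsOrdering m (binsC m))
𝔼-binsSupport m f = trans (∑-map _ _ (choices (binRanges (binsC m)))) (∑-*ˡ (binsWeight (binsC m)) (f ∘ binsOrdering m (binsC m)) (choices (binRanges (binsC m))))

binsWeight-nonneg : ∀ C → 0ℚ ℚ.≤ binsWeight C
binsWeight-nonneg C = pow½-nonneg (foldr ℕ._+_ 0 (map (λ k → C ∸ suc k) (upTo C)))

binsSupport-isDistribution : ∀ m → IsDistribution (binsSupport m)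
binsSupport-isDistribution m = record
  { weights-nonneg = map⁺ (All.universal (λ _ → binsWeight-nonneg (binsC m)) (choices (binRanges (binsC m))))
  ; weights-sum    = begin
      ∑ (binsSupport m) proj₁                                                    ≡⟨ ∑-cong (λ wo → ℚ.*-identityʳ (proj₁ wo)) (binsSupport m) ⟨
      𝔼 (binsSupport m) (λ _ → 1ℚ)                                               ≡⟨ 𝔼-binsSupport m (λ _ → 1ℚ) ⟩
      binsWeight (binsC m) ℚ.* numChoices (binRanges (binsC m))                 ≡⟨ binsWeight-numChoices (binsC m) ⟩
      1ℚ                                                                        ∎
  }
  where open ≡-Reasoning

-- Positions of the bins

data Ranges (M : ℕ) : ℕ → List ℕ → Set where
  []  : ∀ {k} → Ranges M k []
  _∷_ : ∀ {k r rs} → r * 2 ^ k ≡ M → Ranges M (suc k) rs → Ranges M k (r ∷ rs)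

binRanges-Ranges : ∀ C → Ranges (2 ^ C) 0 (binRanges (suc C))
binRanges-Ranges C = subst (Ranges (2 ^ C) 0) (sym (map-upTo (λ k → 2 ^ (C ∸ k)) (suc C)))
                           (ranges (suc C) 0 (λ i → 2 ^ (C ∸ i)) (λ _ → refl) refl)
  where
  -- `applyUpTo` shifts its function at every step, so the recursion carries an arbitrary `f` that
  -- agrees with the ranges from level `k` on.
  ranges : ∀ n k (f : ℕ → ℕ) → (∀ i → f i ≡ 2 ^ (C ∸ (k ℕ.+ i))) → k ℕ.+ n ≡ suc C → Ranges (2 ^ C) k (applyUpTo f n)
  ranges zero    k f f≗ k+n≡ = []
  ranges (suc n) k f f≗ k+n≡ = full ∷ ranges n (suc k) (f ∘ suc)
      (λ i → trans (f≗ (suc i)) (cong (λ x → 2 ^ (C ∸ x)) (ℕ.+-suc k i))) (trans (sym (ℕ.+-suc k n)) k+n≡)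
    where
    k≤C : k ≤ C
    k≤C = subst (k ≤_) (ℕ.suc-injective (trans (sym (ℕ.+-suc k n)) k+n≡)) (ℕ.m≤m+n k n)
    full : f 0 * 2 ^ k ≡ 2 ^ C
    full = begin
      f 0 * 2 ^ k                     ≡⟨ cong (_* 2 ^ k) (f≗ 0) ⟩
      2 ^ (C ∸ (k ℕ.+ 0)) * 2 ^ k     ≡⟨ cong (λ x → 2 ^ (C ∸ x) * 2 ^ k) (ℕ.+-identityʳ k) ⟩
      2 ^ (C ∸ k) * 2 ^ k             ≡⟨ ℕ.^-distribˡ-+-* 2 (C ∸ k) k ⟨
      2 ^ (C ∸ k ℕ.+ k)               ≡⟨ cong (2 ^_) (ℕ.m∸n+n≡m k≤C) ⟩
      2 ^ C                           ∎
      where open ≡-Reasoning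

data Valid (M : ℕ) : ℕ → List ℕ → Set where
  []  : ∀ {k} → Valid M k []
  _∷_ : ∀ {k j js} → suc j * 2 ^ k ≤ M → Valid M (suc k) js → Valid M k (j ∷ js)

choices-valid : ∀ {M k rs} → Ranges M k rs → All (λ js → Valid M k js × length js ≡ length rs) (choices rs)
choices-valid []                    = ([] , refl) ∷ []
choices-valid {k = k} {rs = r ∷ rs} (refl ∷ ranges) = concat⁺ (map⁺ {xs = upTo r} (All.tabulate λ {j} j∈ →
  map⁺ (All.map (λ (valid , len) → ℕ.*-monoˡ-≤ (2 ^ k) (∈-upTo⁻ j∈) ∷ valid , cong suc len) (choices-valid ranges))))

-- The chunk length `M` is kept abstract; for `M` equal to `2 ^ C` this unfolds to the block listed
-- by `binsPrefix (suc C)`.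
bin : ℕ → ℕ → ℕ → List ℕ
bin M k j = map (λ t → k * M ℕ.+ j * 2 ^ k ℕ.+ t) (upTo (2 ^ k))

∈-bin⁻ : ∀ {M k j x} → x ∈ bin M k j → ∃[ t ] t < 2 ^ k × x ≡ k * M ℕ.+ j * 2 ^ k ℕ.+ t
∈-bin⁻ x∈ with t , t∈ , x≡ ← ∈-map⁻ _ x∈ = t , ∈-upTo⁻ t∈ , x≡

bin-≥ : ∀ {M k j x} → x ∈ bin M k j → k * M ≤ x
bin-≥ {M} {k} {j} x∈ with t , _ , refl ← ∈-bin⁻ {M} {k} {j} x∈ =
  ℕ.≤-trans (ℕ.m≤m+n (k * M) (j * 2 ^ k)) (ℕ.m≤m+n (k * M ℕ.+ j * 2 ^ k) t)

bin-< : ∀ {M k j x} → suc j * 2 ^ k ≤ M → x ∈ bin M k j → x < suc k * M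
bin-< {M} {k} {j} j≤ x∈ with t , t< , refl ← ∈-bin⁻ {M} {k} {j} x∈ = begin-strict
  k * M ℕ.+ j * 2 ^ k ℕ.+ t       <⟨ ℕ.+-monoʳ-< (k * M ℕ.+ j * 2 ^ k) t< ⟩
  k * M ℕ.+ j * 2 ^ k ℕ.+ 2 ^ k   ≡⟨ ℕ.+-assoc (k * M) (j * 2 ^ k) (2 ^ k) ⟩
  k * M ℕ.+ (j * 2 ^ k ℕ.+ 2 ^ k) ≡⟨ cong (k * M ℕ.+_) (ℕ.+-comm (j * 2 ^ k) (2 ^ k)) ⟩
  k * M ℕ.+ suc j * 2 ^ k         ≤⟨ ℕ.+-monoʳ-≤ (k * M) j≤ ⟩
  k * M ℕ.+ M                     ≡⟨ ℕ.+-comm (k * M) M ⟩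
  suc k * M                       ∎
  where open ℕ.≤-Reasoning

quotient-mono : ∀ {n i j s t} → s < n → i < j → i * n ℕ.+ s < j * n ℕ.+ t
quotient-mono {n} {i} {j} {s} {t} s<n i<j = begin-strict
  i * n ℕ.+ s <⟨ ℕ.+-monoʳ-< (i * n) s<n ⟩
  i * n ℕ.+ n ≡⟨ ℕ.+-comm (i * n) n ⟩
  suc i * n   ≤⟨ ℕ.*-monoˡ-≤ n i<j ⟩
  j * n       ≤⟨ ℕ.m≤m+n (j * n) t ⟩
  j * n ℕ.+ t ∎
  where open ℕ.≤-Reasoning

-- After removing the offset of the chunk, the bin index is the quotient by `2 ^ k`.
bin-injective : ∀ {M k i j x} → x ∈ bin M k i → x ∈ bin M k j → i ≡ j
bin-injective {M} {k} {i} {j} x∈i x∈j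
  with s , s< , refl ← ∈-bin⁻ {M} {k} {i} x∈i | t , t< , x≡ ← ∈-bin⁻ {M} {k} {j} x∈j
  with eq ← ℕ.+-cancelˡ-≡ (k * M) _ _ (trans (sym (ℕ.+-assoc (k * M) (i * 2 ^ k) s)) (trans x≡ (ℕ.+-assoc (k * M) (j * 2 ^ k) t)))
  with ℕ.<-cmp i j
... | tri< i<j _ _ = ⊥-elim (ℕ.<⇒≢ (quotient-mono s< i<j) eq)
... | tri≈ _ i≡j _ = i≡j
... | tri> _ _ j<i = ⊥-elim (ℕ.<⇒≢ (quotient-mono t< j<i) (sym eq))

binsPrefix-≥ : ∀ C {k js x} → x ∈ binsPrefix (suc C) k js → k * 2 ^ C ≤ x
binsPrefix-≥ C {k} {j ∷ js} x∈ with ∈-++⁻ (bin (2 ^ C) k j) x∈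
... | inj₁ x∈bin  = bin-≥ {2 ^ C} {k} {j} x∈bin
... | inj₂ x∈rest = ℕ.≤-trans (ℕ.m≤n+m (k * 2 ^ C) (2 ^ C)) (binsPrefix-≥ C {suc k} {js} x∈rest)

length-bin : ∀ M k j → length (bin M k j) ≡ 2 ^ k
length-bin M k j = trans (length-map _ (upTo (2 ^ k))) (length-upTo (2 ^ k))

-- A geometric sum of bin sizes, stated additively to avoid truncated subtraction.
length-binsPrefix : ∀ C k js → length (binsPrefix (suc C) k js) ℕ.+ 2 ^ k ≡ 2 ^ (k ℕ.+ length js)
length-binsPrefix C k []       = cong (2 ^_) (sym (ℕ.+-identityʳ k))
length-binsPrefix C k (j ∷ js) = begin
  length (bin (2 ^ C) k j ++ binsPrefix (suc C) (suc k) js) ℕ.+ 2 ^ k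
    ≡⟨ cong (ℕ._+ 2 ^ k) (trans (length-++ (bin (2 ^ C) k j)) (cong (ℕ._+ length (binsPrefix (suc C) (suc k) js)) (length-bin (2 ^ C) k j))) ⟩
  2 ^ k ℕ.+ length (binsPrefix (suc C) (suc k) js) ℕ.+ 2 ^ k
    ≡⟨ ℕ-Solver.solve 2 (λ a b → a ℕ-Solver.:+ b ℕ-Solver.:+ a ℕ-Solver.:= b ℕ-Solver.:+ ℕ-Solver.con 2 ℕ-Solver.:* a) refl (2 ^ k) (length (binsPrefix (suc C) (suc k) js)) ⟩
  length (binsPrefix (suc C) (suc k) js) ℕ.+ 2 ^ suc k
    ≡⟨ length-binsPrefix C (suc k) js ⟩
  2 ^ (suc k ℕ.+ length js)
    ≡⟨ cong (2 ^_) (ℕ.+-suc k (length js)) ⟨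
  2 ^ (k ℕ.+ suc (length js)) ∎
  where open ≡-Reasoning

-- Levels at which two instances share a bin

∈-take-++ : ∀ d (xs : List ℕ) {ys x} → x ∈ take d (xs ++ ys) → x ∈ xs ⊎ x ∈ take (d ∸ length xs) ys
∈-take-++ d       []       x∈          = inj₂ x∈
∈-take-++ (suc d) (y ∷ xs) (here x≡y)  = inj₁ (here x≡y)
∈-take-++ (suc d) (y ∷ xs) (there x∈) with ∈-take-++ d xs x∈
... | inj₁ x∈xs = inj₁ (there x∈xs)
... | inj₂ x∈ys = inj₂ x∈ys

take-++-≤ : ∀ d (xs ys : List ℕ) → d ≤ length xs → take d (xs ++ ys) ≡ take d xs
take-++-≤ zero    xs       ys _        = refl
take-++-≤ (suc d) (x ∷ xs) ys (s≤s d≤) = cong (x ∷_) (take-++-≤ d xs ys d≤)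

∈-take⁻ : ∀ d (xs : List ℕ) {x} → x ∈ take d xs → x ∈ xs
∈-take⁻ (suc d) (y ∷ xs) (here x≡y) = here x≡y
∈-take⁻ (suc d) (y ∷ xs) (there x∈) = there (∈-take⁻ d xs x∈)

-- Only levels that the first instance reaches within `d` requests count: `d` drops by the bin size
-- at each level, and 0 stops the count.
agreements : ℕ → ℕ → List ℕ → List ℕ → ℚ
agreements k zero      _        _        = 0ℚ
agreements k d@(suc _) []       _        = 0ℚ
agreements k d@(suc _) (_ ∷ _)  []       = 0ℚ
agreements k d@(suc _) (i ∷ is) (j ∷ js) = χ (does (i ℕ.≟ j)) ℚ.+ agreements (suc k) (d ∸ 2 ^ k) is js

agreements-nonneg : ∀ k d is js → 0ℚ ℚ.≤ agreements k d is js
agreements-nonneg k zero      _        _        = ℚ.≤-refl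
agreements-nonneg k d@(suc _) []       _        = ℚ.≤-refl
agreements-nonneg k d@(suc _) (_ ∷ _)  []       = ℚ.≤-refl
agreements-nonneg k d@(suc _) (i ∷ is) (j ∷ js) = +-nonneg (χ-nonneg (does (i ℕ.≟ j))) (agreements-nonneg (suc k) (d ∸ 2 ^ k) is js)

-- An ID lies in one chunk and in one bin of it, so a common ID forces equal choices at some level,
-- and the prefix of length `d` has to reach that level. The second instance enters with all its
-- bins, which covers every prefix of them.
agree-or-disjoint : ∀ C {k} d {is js} → Valid (2 ^ C) k is → Valid (2 ^ C) k js →
  1ℚ ℚ.≤ agreements k d is js ⊎ Disjoint (binsPrefix (suc C) k js) (take d (binsPrefix (suc C) k is))
agree-or-disjoint C zero      _  _  = inj₂ λ { (_ , ()) }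
agree-or-disjoint C d@(suc _) [] _  = inj₂ λ { (_ , ()) }
agree-or-disjoint C d@(suc _) (_ ∷ _) [] = inj₂ λ { (() , _) }
agree-or-disjoint C {k} d@(suc _) {i ∷ is} {j ∷ js} (i≤ ∷ is-valid) (j≤ ∷ js-valid)
  with i ℕ.≟ j | agree-or-disjoint C {suc k} (d ∸ 2 ^ k) is-valid js-valid
... | yes i≡j | _          = inj₁ (≤-from-slack (agreements-nonneg (suc k) (d ∸ 2 ^ k) is js)
  (cong (λ b → χ b ℚ.+ agreements (suc k) (d ∸ 2 ^ k) is js) (sym (dec-true (i ℕ.≟ j) i≡j))))
... | no _    | inj₁ agree = inj₁ (ℚ.≤-trans agree
  (≤-from-slack (χ-nonneg (does (i ℕ.≟ j))) (ℚ.+-comm (agreements (suc k) (d ∸ 2 ^ k) is js) _)))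
... | no i≢j  | inj₂ disj  = inj₂ λ (x∈js , x∈is) → separate (∈-++⁻ (bin (2 ^ C) k j) x∈js) (split x∈is)
  where
  split : ∀ {x} → x ∈ take d (bin (2 ^ C) k i ++ binsPrefix (suc C) (suc k) is) →
          x ∈ bin (2 ^ C) k i ⊎ x ∈ take (d ∸ 2 ^ k) (binsPrefix (suc C) (suc k) is)
  split x∈ = subst (λ n → _ ∈ bin (2 ^ C) k i ⊎ _ ∈ take (d ∸ n) (binsPrefix (suc C) (suc k) is))
                   (length-bin (2 ^ C) k i) (∈-take-++ d (bin (2 ^ C) k i) x∈)
  separate : ∀ {x} → x ∈ bin (2 ^ C) k j ⊎ x ∈ binsPrefix (suc C) (suc k) js →
             x ∈ bin (2 ^ C) k i ⊎ x ∈ take (d ∸ 2 ^ k) (binsPrefix (suc C) (suc k) is) → ⊥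
  separate (inj₁ x∈j)  (inj₁ x∈i)  = i≢j (bin-injective {2 ^ C} {k} x∈i x∈j)
  separate (inj₁ x∈j)  (inj₂ x∈is) = ℕ.<⇒≱ (bin-< {2 ^ C} {k} {j} j≤ x∈j) (binsPrefix-≥ C {suc k} {is} (∈-take⁻ (d ∸ 2 ^ k) _ x∈is))
  separate (inj₂ x∈js) (inj₁ x∈i)  = ℕ.<⇒≱ (bin-< {2 ^ C} {k} {i} i≤ x∈i) (binsPrefix-≥ C {suc k} {js} x∈js)
  separate (inj₂ x∈js) (inj₂ x∈is) = disj (x∈js , x∈is)

∑-agree≤1 : ∀ i {xs} → Unique xs → ∑ xs (λ j → χ (does (i ℕ.≟ j))) ℚ.≤ 1ℚ
∑-agree≤1 i [] = ℚ.nonNegative⁻¹ 1ℚ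
∑-agree≤1 i {x ∷ xs} (x∉xs ∷ xs!) = by-cases (i ℕ.≟ x)
  where
  by-cases : (i≟x : Dec (i ≡ x)) → χ (does i≟x) ℚ.+ ∑ xs (λ j → χ (does (i ℕ.≟ j))) ℚ.≤ 1ℚ
  by-cases (yes refl) = ℚ.≤-reflexive (trans
    (cong (1ℚ ℚ.+_) (trans (∑-cong-All (All.map (λ {j} i≢j → cong χ (dec-false (i ℕ.≟ j) i≢j)) x∉xs)) (∑-zero xs)))
    (ℚ.+-identityʳ 1ℚ))
  by-cases (no _) = ℚ.≤-trans (ℚ.≤-reflexive (ℚ.+-identityˡ _)) (∑-agree≤1 i xs!)

-- At most one of the `r` values of `j` agrees with `i`, and it has `numChoices rs` continuations;
-- the later levels are counted once for each `j`.
∑-agreements-∷ : ∀ k d i is r rs → ∑ (choices (r ∷ rs)) (agreements k (suc d) (i ∷ is))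
  ℚ.≤ numChoices rs ℚ.+ ℕ→ℚ r ℚ.* ∑ (choices rs) (agreements (suc k) (suc d ∸ 2 ^ k) is)
∑-agreements-∷ k d i is r rs = begin
  ∑ (choices (r ∷ rs)) (agreements k (suc d) (i ∷ is))
    ≡⟨ ∑-choices (agreements k (suc d) (i ∷ is)) r rs ⟩
  ∑ (upTo r) (λ j → ∑ (choices rs) (λ js → agree j ℚ.+ later js))
    ≡⟨ ∑-cong (λ j → trans (∑-+ (λ _ → agree j) later (choices rs)) (cong (ℚ._+ total) (factor j))) (upTo r) ⟩
  ∑ (upTo r) (λ j → numChoices rs ℚ.* agree j ℚ.+ total)
    ≡⟨ ∑-+ (λ j → numChoices rs ℚ.* agree j) (λ _ → total) (upTo r) ⟩
  ∑ (upTo r) (λ j → numChoices rs ℚ.* agree j) ℚ.+ ∑ (upTo r) (λ _ → total)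
    ≡⟨ cong₂ ℚ._+_ (∑-*ˡ (numChoices rs) agree (upTo r)) (∑-upTo-const r total) ⟩
  numChoices rs ℚ.* ∑ (upTo r) agree ℚ.+ ℕ→ℚ r ℚ.* total
    ≤⟨ ℚ.+-monoˡ-≤ (ℕ→ℚ r ℚ.* total) (*-monoˡ (numChoices-nonneg rs) (∑-agree≤1 i (upTo⁺ r))) ⟩
  numChoices rs ℚ.* 1ℚ ℚ.+ ℕ→ℚ r ℚ.* total
    ≡⟨ cong (ℚ._+ ℕ→ℚ r ℚ.* total) (ℚ.*-identityʳ (numChoices rs)) ⟩
  numChoices rs ℚ.+ ℕ→ℚ r ℚ.* total ∎
  where
  open ℚ.≤-Reasoning
  agree : ℕ → ℚ
  agree j = χ (does (i ℕ.≟ j))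
  later : List ℕ → ℚ
  later = agreements (suc k) (suc d ∸ 2 ^ k) is
  total : ℚ
  total = ∑ (choices rs) later
  factor : ∀ j → ∑ (choices rs) (λ _ → agree j) ≡ numChoices rs ℚ.* agree j
  factor j = trans (∑-const (agree j) (choices rs))
    (cong (ℚ._* agree j) (sym (trans (∑-const 1ℚ (choices rs)) (ℚ.*-identityʳ (ℕ→ℚ (length (choices rs)))))))

-- Agreement at the current level has frequency 1/r = K/M, which becomes the term 2K after scaling
-- by 2M. The later levels keep their bound, as both sides gain the factor r.
agreements-step : ∀ {M T U n⁺} n r K δ → M ≡ r ℚ.* K → n⁺ ≡ r ℚ.* n → 0ℚ ℚ.≤ r →
  U ℚ.≤ n ℚ.+ r ℚ.* T → 0ℚ ℚ.≤ r ℚ.* K →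
  (ℕ→ℚ 2 ℚ.* M) ℚ.* T ℚ.≤ (ℕ→ℚ 4 ℚ.* δ) ℚ.* n →
  (ℕ→ℚ 2 ℚ.* M) ℚ.* U ℚ.≤ (ℕ→ℚ 4 ℚ.* δ ℚ.+ ℕ→ℚ 2 ℚ.* K) ℚ.* n⁺
agreements-step {_} {T} {U} n r K δ refl refl 0≤r U≤ 0≤rK T≤ =
  ≤-from-slack (+-nonneg (*-nonneg (*-nonneg (ℕ→ℚ-nonneg 2) 0≤rK) (slack U≤)) (*-nonneg 0≤r (slack T≤)))
    (solve 6 (λ T U n r K δ →
      con (ℕ→ℚ 2) :* (r :* K) :* U
        :+ (con (ℕ→ℚ 2) :* (r :* K) :* (n :+ r :* T :- U)
            :+ r :* (con (ℕ→ℚ 4) :* δ :* n :- con (ℕ→ℚ 2) :* (r :* K) :* T))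
      := (con (ℕ→ℚ 4) :* δ :+ con (ℕ→ℚ 2) :* K) :* (r :* n)) refl T U n r K δ)

budget-nonneg : ∀ d k rs → 0ℚ ℚ.≤ (ℕ→ℚ 4 ℚ.* ℕ→ℚ d ℚ.+ ℕ→ℚ 2 ℚ.* ℕ→ℚ (2 ^ k)) ℚ.* numChoices rs
budget-nonneg d k rs = *-nonneg (+-nonneg (*-nonneg (ℕ→ℚ-nonneg 4) (ℕ→ℚ-nonneg d)) (*-nonneg (ℕ→ℚ-nonneg 2) (ℕ→ℚ-nonneg (2 ^ k))))
                                (numChoices-nonneg rs)

-- Level l agrees with probability 2 ^ suc l / (2 M) and costs 2 ^ l requests, so
-- the levels reached form a geometric sum dominated by the last one; the summand
-- 2 · 2 ^ k absorbs a first level that is only partly used.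
∑-agreements : ∀ {M k rs} → Ranges M k rs → ∀ d is → 1 ≤ d →
  (ℕ→ℚ 2 ℚ.* ℕ→ℚ M) ℚ.* ∑ (choices rs) (agreements k d is)
    ℚ.≤ (ℕ→ℚ 4 ℚ.* ℕ→ℚ d ℚ.+ ℕ→ℚ 2 ℚ.* ℕ→ℚ (2 ^ k)) ℚ.* numChoices rs
∑-agreements {M} {k} {rs} ranges d@(suc _) [] 1≤d =
  ℚ.≤-trans (ℚ.≤-reflexive (trans (cong ((ℕ→ℚ 2 ℚ.* ℕ→ℚ M) ℚ.*_) (∑-zero (choices rs))) (ℚ.*-zeroʳ (ℕ→ℚ 2 ℚ.* ℕ→ℚ M))))
            (budget-nonneg d k rs)
∑-agreements {M} {k} [] d@(suc _) (_ ∷ _) 1≤d =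
  ℚ.≤-trans (ℚ.≤-reflexive (ℚ.*-zeroʳ (ℕ→ℚ 2 ℚ.* ℕ→ℚ M)))
            (budget-nonneg d k [])
∑-agreements {M} {k} {r ∷ rs} (full ∷ ranges) d@(suc d-1) (i ∷ is) 1≤d =
  agreements-step (numChoices rs) (ℕ→ℚ r) (ℕ→ℚ (2 ^ k)) (ℕ→ℚ d)
    (trans (cong ℕ→ℚ (sym full)) (ℕ→ℚ-* r (2 ^ k))) (numChoices-∷ r rs) (ℕ→ℚ-nonneg r)
    (∑-agreements-∷ k d-1 i is r rs) (*-nonneg (ℕ→ℚ-nonneg r) (ℕ→ℚ-nonneg (2 ^ k))) (later (d ∸ 2 ^ k) refl)
  where
  open ℚ.≤-Reasoning
  -- The requests left after a full bin. If there are none, the sum vanishes; otherwise the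
  -- subtraction is exact, and the next budget 4(d - 2 ^ k) + 2 · 2 ^ (k + 1) equals 4d.
  later : ∀ e → d ∸ 2 ^ k ≡ e →
    (ℕ→ℚ 2 ℚ.* ℕ→ℚ M) ℚ.* ∑ (choices rs) (agreements (suc k) e is) ℚ.≤ (ℕ→ℚ 4 ℚ.* ℕ→ℚ d) ℚ.* numChoices rs
  later zero _ = ℚ.≤-trans (ℚ.≤-reflexive (trans (cong ((ℕ→ℚ 2 ℚ.* ℕ→ℚ M) ℚ.*_) (∑-zero (choices rs))) (ℚ.*-zeroʳ (ℕ→ℚ 2 ℚ.* ℕ→ℚ M))))
                           (*-nonneg (*-nonneg (ℕ→ℚ-nonneg 4) (ℕ→ℚ-nonneg d)) (numChoices-nonneg rs))
  later (suc e) eq = begin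
    (ℕ→ℚ 2 ℚ.* ℕ→ℚ M) ℚ.* ∑ (choices rs) (agreements (suc k) (suc e) is)
      ≤⟨ ∑-agreements ranges (suc e) is (s≤s z≤n) ⟩
    (ℕ→ℚ 4 ℚ.* ℕ→ℚ (suc e) ℚ.+ ℕ→ℚ 2 ℚ.* ℕ→ℚ (2 ^ suc k)) ℚ.* numChoices rs
      ≡⟨ cong (λ x → (ℕ→ℚ 4 ℚ.* ℕ→ℚ (suc e) ℚ.+ ℕ→ℚ 2 ℚ.* x) ℚ.* numChoices rs) (ℕ→ℚ-* 2 (2 ^ k)) ⟩
    (ℕ→ℚ 4 ℚ.* ℕ→ℚ (suc e) ℚ.+ ℕ→ℚ 2 ℚ.* (ℕ→ℚ 2 ℚ.* ℕ→ℚ (2 ^ k))) ℚ.* numChoices rs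
      ≡⟨ cong (ℚ._* numChoices rs) (solve 2 (λ e K → con (ℕ→ℚ 4) :* e :+ con (ℕ→ℚ 2) :* (con (ℕ→ℚ 2) :* K) := con (ℕ→ℚ 4) :* (e :+ K)) refl (ℕ→ℚ (suc e)) (ℕ→ℚ (2 ^ k))) ⟩
    (ℕ→ℚ 4 ℚ.* (ℕ→ℚ (suc e) ℚ.+ ℕ→ℚ (2 ^ k))) ℚ.* numChoices rs
      ≡⟨ cong (λ x → (ℕ→ℚ 4 ℚ.* x) ℚ.* numChoices rs) (trans (sym (ℕ→ℚ-+ (suc e) (2 ^ k)))
           (cong ℕ→ℚ split)) ⟩
    (ℕ→ℚ 4 ℚ.* ℕ→ℚ d) ℚ.* numChoices rs ∎
    where
    split : suc e ℕ.+ 2 ^ k ≡ d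
    split = trans (cong (ℕ._+ 2 ^ k) (sym eq))
      (ℕ.m∸n+n≡m (ℕ.<⇒≤ (ℕ.m∸n≢0⇒n<m {d} {2 ^ k} (λ d∸≡0 → ℕ.1+n≢0 (trans (sym eq) d∸≡0)))))

disjoint-bound : ∀ {xs ys p} → 0ℚ ℚ.≤ p → 1ℚ ℚ.≤ p ⊎ Disjoint xs ys → 1ℚ ℚ.- χdisj xs ys ℚ.≤ p
disjoint-bound {xs} {ys} 0≤p (inj₁ 1≤p) = ℚ.≤-trans
  (≤-from-slack (χ-nonneg (disjointᵇ xs ys)) (solve 1 (λ c → con 1ℚ :- c :+ c := con 1ℚ) refl (χdisj xs ys))) 1≤p
disjoint-bound {xs} {ys} 0≤p (inj₂ xs#ys) =
  ℚ.≤-trans (ℚ.≤-reflexive (cong (λ b → 1ℚ ℚ.- χ b) (dec-true (disjoint? xs ys) xs#ys))) 0≤p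

-- Collision probability of Bins*

module BinsCollisions (m : ℕ) {C : ℕ} (C≡ : binsC m ≡ suc C) where

  private
    W = binsSupport m
    rs = binRanges (suc C)
    ranges = binRanges-Ranges C

  length-rs : length rs ≡ suc C
  length-rs = trans (length-map _ (upTo (suc C))) (length-upTo (suc C))

  -- The bins of an instance hold `2 ^ suc C` - 1 IDs in all, so a demand below `2 ^ suc C` never
  -- reaches the leftover IDs.
  take-binsOrdering : ∀ {d js} → d < 2 ^ suc C → length js ≡ length rs →
                      take d (binsOrdering m (suc C) js) ≡ take d (binsPrefix (suc C) 0 js)
  take-binsOrdering {d} {js} d< len = take-++-≤ d (binsPrefix (suc C) 0 js) _ (ℕ.≤-pred (begin-strict
    d                                        <⟨ d< ⟩
    2 ^ suc C                                ≡⟨ cong (2 ^_) (trans len length-rs) ⟨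
    2 ^ length js                            ≡⟨ length-binsPrefix C 0 js ⟨
    length (binsPrefix (suc C) 0 js) ℕ.+ 1   ≡⟨ ℕ.+-comm _ 1 ⟩
    suc (length (binsPrefix (suc C) 0 js))   ∎))
    where open ℕ.≤-Reasoning

  -- Two instances meet with probability at most (4d + 2) / 2 ^ (C + 1), and 4d + 2 ≤ 6d.
  κ : ℚ
  κ = ℕ→ℚ 6 ℚ.* powℚ ½ (suc C)

  Allowed : ℕ → Set
  Allowed d = 1 ≤ d × d < 2 ^ suc C

  open UnionBound (binsSupport-isDistribution m)

  meets-≤-agreements : ∀ {d e is js} → d < 2 ^ suc C → e < 2 ^ suc C →
    Valid (2 ^ C) 0 is × length is ≡ length rs → Valid (2 ^ C) 0 js × length js ≡ length rs →
    1ℚ ℚ.- χdisj (take e (binsOrdering m (suc C) js)) (take d (binsOrdering m (suc C) is)) ℚ.≤ agreements 0 d is js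
  meets-≤-agreements {d} {e} {is} {js} d< e< (is-valid , is-length) (js-valid , js-length)
    rewrite take-binsOrdering {d} {is} d< is-length | take-binsOrdering {e} {js} e< js-length =
    disjoint-bound (agreements-nonneg 0 d is js) (shrink (agree-or-disjoint C d is-valid js-valid))
    where
    shrink : ∀ {p xs ys} → 1ℚ ℚ.≤ p ⊎ Disjoint xs ys → 1ℚ ℚ.≤ p ⊎ Disjoint (take e xs) ys
    shrink (inj₁ 1≤p)   = inj₁ 1≤p
    shrink (inj₂ xs#ys) = inj₂ λ (v∈xs , v∈ys) → xs#ys (∈-take⁻ e _ v∈xs , v∈ys)

  weighted-agreements : ∀ {d} is → 1 ≤ d → binsWeight (suc C) ℚ.* ∑ (choices rs) (agreements 0 d is) ℚ.≤ κ ℚ.* ℕ→ℚ d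
  weighted-agreements {d} is 1≤d = bound (binsWeight (suc C)) (powℚ ½ (suc C)) (∑ (choices rs) (agreements 0 d is)) (numChoices rs) (ℕ→ℚ (2 ^ C)) (ℕ→ℚ d)
    (binsWeight-nonneg (suc C)) (pow½-nonneg (suc C)) (numChoices-nonneg rs) (binsWeight-numChoices (suc C))
    (trans (cong (powℚ ½ (suc C) ℚ.*_) (sym (ℕ→ℚ-* 2 (2 ^ C)))) (pow½-cancel (suc C)))
    (ℕ→ℚ-mono 1≤d) (∑-agreements ranges d is 1≤d)
    where
    bound : ∀ w h T n M δ → 0ℚ ℚ.≤ w → 0ℚ ℚ.≤ h → 0ℚ ℚ.≤ n → w ℚ.* n ≡ 1ℚ → h ℚ.* (ℕ→ℚ 2 ℚ.* M) ≡ 1ℚ → 1ℚ ℚ.≤ δ →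
      (ℕ→ℚ 2 ℚ.* M) ℚ.* T ℚ.≤ (ℕ→ℚ 4 ℚ.* δ ℚ.+ ℕ→ℚ 2 ℚ.* 1ℚ) ℚ.* n → w ℚ.* T ℚ.≤ (ℕ→ℚ 6 ℚ.* h) ℚ.* δ
    bound w h T n M δ 0≤w 0≤h 0≤n wn≡1 hM≡1 1≤δ T≤ = begin
      w ℚ.* T
        ≡⟨ ℚ.*-identityˡ (w ℚ.* T) ⟨
      1ℚ ℚ.* (w ℚ.* T)
        ≡⟨ cong (ℚ._* (w ℚ.* T)) hM≡1 ⟨
      h ℚ.* (ℕ→ℚ 2 ℚ.* M) ℚ.* (w ℚ.* T)
        ≤⟨ ≤-from-slack (+-nonneg (*-nonneg 0≤hw (slack T≤)) (*-nonneg (*-nonneg (ℕ→ℚ-nonneg 2) (*-nonneg 0≤hw 0≤n)) (slack 1≤δ)))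
             (solve 6 (λ w h T n M δ →
               h :* (con (ℕ→ℚ 2) :* M) :* (w :* T)
                 :+ (h :* w :* ((con (ℕ→ℚ 4) :* δ :+ con (ℕ→ℚ 2) :* con 1ℚ) :* n :- (con (ℕ→ℚ 2) :* M) :* T)
                     :+ con (ℕ→ℚ 2) :* (h :* w :* n) :* (δ :- con 1ℚ))
               := con (ℕ→ℚ 6) :* h :* δ :* (w :* n)) refl w h T n M δ) ⟩
      ℕ→ℚ 6 ℚ.* h ℚ.* δ ℚ.* (w ℚ.* n)
        ≡⟨ trans (cong ((ℕ→ℚ 6 ℚ.* h ℚ.* δ) ℚ.*_) wn≡1) (ℚ.*-identityʳ (ℕ→ℚ 6 ℚ.* h ℚ.* δ)) ⟩
      ℕ→ℚ 6 ℚ.* h ℚ.* δ ∎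
      where
      open ℚ.≤-Reasoning
      0≤hw : 0ℚ ℚ.≤ h ℚ.* w
      0≤hw = *-nonneg 0≤h 0≤w

  meetProb-prefix : ∀ {d e} → Allowed d → Allowed e →
    All (λ wo → meetProb e (take d (proj₂ wo)) ℚ.≤ κ ℚ.* ℕ→ℚ d) W
  -- The bound is proved for `suc C` and carried back along `C≡` to `binsC m`, from which `W` is
  -- built.
  meetProb-prefix {d} {e} (1≤d , d<) (_ , e<) = map⁺ (subst
    (λ c → All (λ is → meetProb e (take d (binsOrdering m c is)) ℚ.≤ κ ℚ.* ℕ→ℚ d) (choices (binRanges c))) (sym C≡)
    (All.map (λ {is} → pointwise is) (choices-valid ranges)))
    where
    open ℚ.≤-Reasoning
    pointwise : ∀ is → Valid (2 ^ C) 0 is × length is ≡ length rs →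
      meetProb e (take d (binsOrdering m (suc C) is)) ℚ.≤ κ ℚ.* ℕ→ℚ d
    pointwise is is-ok = begin
      meetProb e used
        ≡⟨ 𝔼-binsSupport m (λ o → 1ℚ ℚ.- χdisj (take e o) used) ⟩
      binsWeight (binsC m) ℚ.* ∑ (choices (binRanges (binsC m))) (λ js → 1ℚ ℚ.- χdisj (take e (binsOrdering m (binsC m) js)) used)
        ≡⟨ cong (λ c → binsWeight c ℚ.* ∑ (choices (binRanges c)) (λ js → 1ℚ ℚ.- χdisj (take e (binsOrdering m c js)) used)) C≡ ⟩
      binsWeight (suc C) ℚ.* ∑ (choices rs) (λ js → 1ℚ ℚ.- χdisj (take e (binsOrdering m (suc C) js)) used)
        ≤⟨ *-monoˡ (binsWeight-nonneg (suc C)) (∑-mono (All.map (meets-≤-agreements d< e< is-ok) (choices-valid ranges))) ⟩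
      binsWeight (suc C) ℚ.* ∑ (choices rs) (agreements 0 d is)
        ≤⟨ weighted-agreements is 1≤d ⟩
      κ ℚ.* ℕ→ℚ d ∎
      where
      used : List ℕ
      used = take d (binsOrdering m (suc C) is)

  pColl-bins-≤ : ∀ {ds} → All Allowed ds → pColl W ds ℚ.≤ κ ℚ.* ℕ→ℚ (pairDemand ds)
  pColl-bins-≤ {ds} ok = ℚ.≤-trans (collision-union-bound κ Allowed meetProb-prefix ok [])
    (ℚ.≤-reflexive (trans (cong (ℚ._+ κ ℚ.* ℕ→ℚ (pairDemand ds)) (∑-meetProb-[] ds)) (ℚ.+-identityˡ _)))

-- The number of chunks

n<2^n : ∀ n → n < 2 ^ n
n<2^n zero    = s≤s z≤n
n<2^n (suc n) = begin-strict
  suc n         <⟨ s≤s (n<2^n n) ⟩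
  1 ℕ.+ 2 ^ n   ≤⟨ ℕ.+-monoˡ-≤ (2 ^ n) (ℕ.m^n>0 2 n) ⟩
  2 ^ n ℕ.+ 2 ^ n ≡⟨ cong (2 ^ n ℕ.+_) (ℕ.+-identityʳ (2 ^ n)) ⟨
  2 ^ suc n     ∎
  where open ℕ.≤-Reasoning

-- The search either stops at a successful test or uses up its fuel at k + fuel, where the
-- hypothesis supplies the inequality.
findC-correct : ∀ m k fuel → 2 ^ m ≤ m ^ (2 ^ (k ℕ.+ fuel)) → 2 ^ m ≤ m ^ (2 ^ findC m k fuel)
findC-correct m k zero       ok = subst (λ n → 2 ^ m ≤ m ^ (2 ^ n)) (ℕ.+-identityʳ k) ok
findC-correct m k (suc fuel) ok with 2 ^ m ≤ᵇ m ^ (2 ^ k) in eq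
... | true  = ℕ.≤ᵇ⇒≤ (2 ^ m) (m ^ (2 ^ k)) (subst T (sym eq) tt)
... | false = findC-correct m (suc k) fuel (subst (λ n → 2 ^ m ≤ m ^ (2 ^ n)) (ℕ.+-suc k fuel) ok)

binsC-correct : ∀ {m} → 2 ≤ m → 2 ^ m ≤ m ^ (2 ^ binsC m)
binsC-correct {m@(suc _)} 2≤m = findC-correct m 0 m
  -- The value m passes the test: 2 ^ m ≤ m ^ m ≤ m ^ (2 ^ m).
  (ℕ.≤-trans (ℕ.^-monoˡ-≤ m 2≤m) (ℕ.^-monoʳ-≤ m (ℕ.<⇒≤ (n<2^n m))))

-- Strong induction through ⌈n/2⌉, whose logarithm is one less when n ≥ 2.
n≤2^⌈log₂n⌉ : ∀ n → n ≤ 2 ^ ⌈log₂ n ⌉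
n≤2^⌈log₂n⌉ = <-rec (λ n → n ≤ 2 ^ ⌈log₂ n ⌉) go
  where
  open ℕ.≤-Reasoning
  go : ∀ n → (∀ {k} → k < n → k ≤ 2 ^ ⌈log₂ k ⌉) → n ≤ 2 ^ ⌈log₂ n ⌉
  go 0 _ = z≤n
  go 1 _ = ℕ.m^n>0 2 ⌈log₂ 1 ⌉
  go n@(suc (suc k)) ih = begin
    n                              ≡⟨ ℕ.⌊n/2⌋+⌈n/2⌉≡n n ⟨
    ℕ.⌊ n /2⌋ ℕ.+ ⌈ n /2⌉          ≤⟨ ℕ.+-monoˡ-≤ ⌈ n /2⌉ (ℕ.⌊n/2⌋≤⌈n/2⌉ n) ⟩
    ⌈ n /2⌉ ℕ.+ ⌈ n /2⌉            ≡⟨ cong (⌈ n /2⌉ ℕ.+_) (ℕ.+-identityʳ ⌈ n /2⌉) ⟨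
    2 * ⌈ n /2⌉                    ≤⟨ ℕ.*-monoʳ-≤ 2 (ih (ℕ.⌈n/2⌉<n k)) ⟩
    2 ^ suc ⌈log₂ ⌈ n /2⌉ ⌉        ≡⟨ cong (λ l → 2 ^ suc l) (⌈log₂⌈n/2⌉⌉≡⌈log₂n⌉∸1 n) ⟩
    2 ^ suc (⌈log₂ n ⌉ ∸ 1)        ≡⟨ cong (2 ^_) (ℕ.m+[n∸m]≡n {1} {⌈log₂ n ⌉} (1≤⌈log₂n⌉ (s≤s (s≤s z≤n)))) ⟩
    2 ^ ⌈log₂ n ⌉                  ∎
    where
    1≤⌈log₂n⌉ : 2 ≤ n → 1 ≤ ⌈log₂ n ⌉
    1≤⌈log₂n⌉ = ⌈log₂⌉-mono-≤ {2}

-- Exponents are compared in 2 ^ m ≤ m ^ (2 ^ C) ≤ 2 ^ (⌈log m⌉ · 2 ^ C). This is where the factor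
-- log m of the competitive ratio arises.
m≤log*2^C : ∀ {m} → 2 ≤ m → m ≤ ⌈log₂ m ⌉ * 2 ^ binsC m
m≤log*2^C {m} 2≤m = ℕ.≮⇒≥ λ lt → ℕ.<⇒≱ (ℕ.^-monoʳ-< 2 (s≤s (s≤s z≤n)) lt) (begin
  2 ^ m                             ≤⟨ binsC-correct 2≤m ⟩
  m ^ (2 ^ binsC m)                 ≤⟨ ℕ.^-monoˡ-≤ (2 ^ binsC m) (n≤2^⌈log₂n⌉ m) ⟩
  (2 ^ ⌈log₂ m ⌉) ^ (2 ^ binsC m)   ≡⟨ ℕ.^-*-assoc 2 ⌈log₂ m ⌉ (2 ^ binsC m) ⟩
  2 ^ (⌈log₂ m ⌉ * 2 ^ binsC m)     ∎)
  where open ℕ.≤-Reasoning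

-- The hypothesis `m ^ d < 2 ^ m` says d < m / log m, whereas 2 ^ C is at least m / log m.
demand<2^C : ∀ {m d} → 2 ≤ m → m ^ d < 2 ^ m → d < 2 ^ binsC m
demand<2^C {m@(suc _)} 2≤m m^d< = ℕ.≰⇒> λ 2^C≤d →
  ℕ.<⇒≱ m^d< (ℕ.≤-trans (binsC-correct 2≤m) (ℕ.^-monoʳ-≤ m 2^C≤d))

-- Comparison of the two bounds

compare-bounds : ∀ {pB pA x h M} L μ → 1ℚ ℚ.≤ L → 0ℚ ℚ.≤ pA → 0ℚ ℚ.≤ h → pB ℚ.≤ 1ℚ →
  pB ℚ.≤ (ℕ→ℚ 6 ℚ.* h) ℚ.* x → μ ℚ.≤ L ℚ.* M → h ℚ.* M ≡ 1ℚ →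
  1ℚ ℚ.- pA ℚ.≤ ¾ ⊎ x ℚ.≤ (ℕ→ℚ 8 ℚ.* μ) ℚ.* pA →
  pB ℚ.≤ (ℕ→ℚ 48 ℚ.* L) ℚ.* pA
-- A collision probability of at least 1/4 makes 48 L pA at least 12; the 11 is the surplus over pB
-- ≤ 1.
compare-bounds {pB} {pA} {x} {h} {M} L μ 1≤L 0≤pA 0≤h pB≤1 pB≤ μ≤ hM≡1 (inj₁ ¼≤pA) = ≤-from-slack
  (+-nonneg (+-nonneg (+-nonneg (slack pB≤1) (*-nonneg (*-nonneg (ℕ→ℚ-nonneg 48) 0≤pA) (slack 1≤L)))
                      (*-nonneg (ℕ→ℚ-nonneg 48) (slack ¼≤pA))) (ℕ→ℚ-nonneg 11))
  (solve 3 (λ b a L → b :+ (((con 1ℚ :- b) :+ con (ℕ→ℚ 48) :* a :* (L :- con 1ℚ))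
                             :+ con (ℕ→ℚ 48) :* (con ¾ :- (con 1ℚ :- a)) :+ con (ℕ→ℚ 11))
                     := con (ℕ→ℚ 48) :* L :* a) refl pB pA L)
-- The 6 of the upper bound and the 8 of the lower bound multiply to 48, and hM = 1 trades μ for L.
compare-bounds {pB} {pA} {x} {h} {M} L μ 1≤L 0≤pA 0≤h pB≤1 pB≤ μ≤ hM≡1 (inj₂ x≤) = begin
  pB
    ≤⟨ ≤-from-slack (+-nonneg (+-nonneg (slack pB≤) (*-nonneg (*-nonneg (ℕ→ℚ-nonneg 6) 0≤h) (slack x≤)))
                              (*-nonneg (*-nonneg (ℕ→ℚ-nonneg 48) (*-nonneg 0≤h 0≤pA)) (slack μ≤)))
        (solve 7 (λ b a x h M L μ →
          b :+ ((con (ℕ→ℚ 6) :* h :* x :- b)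
                :+ con (ℕ→ℚ 6) :* h :* (con (ℕ→ℚ 8) :* μ :* a :- x)
                :+ con (ℕ→ℚ 48) :* (h :* a) :* (L :* M :- μ))
          := con (ℕ→ℚ 48) :* L :* a :* (h :* M)) refl pB pA x h M L μ) ⟩
  ℕ→ℚ 48 ℚ.* L ℚ.* pA ℚ.* (h ℚ.* M)
    ≡⟨ trans (cong ((ℕ→ℚ 48 ℚ.* L ℚ.* pA) ℚ.*_) hM≡1) (ℚ.*-identityʳ (ℕ→ℚ 48 ℚ.* L ℚ.* pA)) ⟩
  ℕ→ℚ 48 ℚ.* L ℚ.* pA ∎
  where open ℚ.≤-Reasoning

pColl-↭ : ∀ W {ds es} → ds ↭ es → pColl W ds ≡ pColl W es
pColl-↭ W p = cong (λ n → 1ℚ ℚ.- n) (noCollision-↭ W p [])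

pColl≤1 : ∀ {W} → IsDistribution W → ∀ ds → pColl W ds ℚ.≤ 1ℚ
pColl≤1 {W} dist ds = ≤-from-slack (noCollision-nonneg dist ds [])
  (solve 1 (λ n → con 1ℚ :- n :+ n := con 1ℚ) refl (noCollision W ds []))

sorted-bound : ∀ {m} → 2 ≤ m → ∀ {ds} → AllPairs _≤_ ds → All (λ d → 1 ≤ d × d ≤ m × m ^ d < 2 ^ m) ds →
  ∀ (A : Algorithm m) → pColl (binsSupport m) ds ℚ.≤ ℕ→ℚ (48 * ⌈log₂ m ⌉) ℚ.* pColl (support A) ds
sorted-bound {m} 2≤m [] [] A = ℚ.≤-reflexive (sym (ℚ.*-zeroʳ (ℕ→ℚ (48 * ⌈log₂ m ⌉))))
sorted-bound {m} 2≤m {d ∷ ds} sorted bounds@((1≤d , _ , m^d<) ∷ _) A = by-cases (binsC m) refl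
  where
  L n pB pA : ℚ
  L  = ℕ→ℚ ⌈log₂ m ⌉
  n  = noCollision (support A) (d ∷ ds) []
  pB = pColl (binsSupport m) (d ∷ ds)
  pA = pColl (support A) (d ∷ ds)
  dist : IsDistribution (support A)
  dist = isDistribution A
  lower : n ℚ.≤ ¾ ⊎ ℕ→ℚ (pairDemand (d ∷ ds)) ℚ.≤ (ℕ→ℚ 8 ℚ.* ℕ→ℚ m) ℚ.* (1ℚ ℚ.- n) →
          1ℚ ℚ.- pA ℚ.≤ ¾ ⊎ ℕ→ℚ (pairDemand (d ∷ ds)) ℚ.≤ (ℕ→ℚ 8 ℚ.* ℕ→ℚ m) ℚ.* pA
  lower (inj₁ n≤¾) = inj₁ (subst (ℚ._≤ ¾) (solve 1 (λ n → n := con 1ℚ :- (con 1ℚ :- n)) refl n) n≤¾)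
  lower (inj₂ x≤)  = inj₂ x≤
  by-cases : ∀ c → binsC m ≡ c → pB ℚ.≤ ℕ→ℚ (48 * ⌈log₂ m ⌉) ℚ.* pA
  -- Without chunks, d < 2 ^ 0 would contradict d ≥ 1.
  by-cases zero    C≡ = ⊥-elim (ℕ.<⇒≱ (subst (λ c → d < 2 ^ c) C≡ (demand<2^C 2≤m m^d<)) 1≤d)
  by-cases (suc C) C≡ = subst (λ y → pB ℚ.≤ y ℚ.* pA) (sym (ℕ→ℚ-* 48 ⌈log₂ m ⌉))
    (compare-bounds L (ℕ→ℚ m) (ℕ→ℚ-mono (⌈log₂⌉-mono-≤ 2≤m)) (slack (noCollision≤1 dist (d ∷ ds) []))
      (pow½-nonneg (suc C)) (pColl≤1 (binsSupport-isDistribution m) (d ∷ ds))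
      (BinsCollisions.pColl-bins-≤ m C≡ (All.map (λ {e} (1≤e , _ , m^e<) → 1≤e , subst (λ c → e < 2 ^ c) C≡ (demand<2^C 2≤m m^e<)) bounds))
      m≤LM (pow½-cancel (suc C))
      (lower (noCollision-upper A sorted (All.map (λ (1≤e , e≤m , _) → 1≤e , e≤m) bounds))))
    where
    m≤LM : ℕ→ℚ m ℚ.≤ L ℚ.* ℕ→ℚ (2 ^ suc C)
    m≤LM = ℚ.≤-trans (ℕ→ℚ-mono (subst (λ c → m ≤ ⌈log₂ m ⌉ * 2 ^ c) C≡ (m≤log*2^C 2≤m)))
                     (ℚ.≤-reflexive (ℕ→ℚ-* ⌈log₂ m ⌉ (2 ^ suc C)))

theorem3p9 : ∃[ c ] ∀ (m : ℕ) → 2 ≤ m →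
    ∀ (D : List ℕ) → 2 ≤ length D →
    All (λ d → 1 ≤ d × d ≤ m × m ^ d < 2 ^ m) D →
    ∀ (A : Algorithm m) →
    pColl (binsSupport m) D ℚ.≤ (ℕ→ℚ (c * ⌈log₂ m ⌉) ℚ.* pColl (support A) D)
theorem3p9 = 48 , λ m 2≤m D _ bounds A →
  -- Both probabilities are unchanged by reordering the demands, so it suffices to treat the sorted
  -- list.
  subst₂ (λ pB pA → pB ℚ.≤ ℕ→ℚ (48 * ⌈log₂ m ⌉) ℚ.* pA)
    (pColl-↭ (binsSupport m) (sort-↭ D)) (pColl-↭ (support A) (sort-↭ D))
    (sorted-bound 2≤m (Linked⇒AllPairs ℕ.≤-trans (sort-↗ D)) (All-resp-↭ (↭.↭-sym (sort-↭ D)) bounds) A)
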